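{- Let $A$ be a matrix over a (finite or infinite) field $\mathbb{F}$. The branch-depth $\operatorname{bd}(A)$ of $A$ is equal to the minimum dual tree-depth $\operatorname{td}_D(A')$ of any matrix $A'$ that is row-equivalent to $A$.
   Context: Depth and height: the depth of a rooted tree is the maximum number of edges on a path from the root to a leaf; the height of a rooted tree is the maximum number of vertices on such a path, and the height of a rooted forest is the maximum height of one of its trees. A leaf is a vertex with no children. Tree-depth: the closure $\operatorname{cl}(F)$ of a rooted forest $F$ is the graph obtained by adding edges from each vertex to all its descendants. The tree-depth $\operatorname{td}(G)$ of a graph $G$ is the minimum height of a rooted forest $F$ such that $\operatorname{cl}(F)$ contains $G$ as a subgraph. Dual tree-depth: the dual graph $G_D(A)$ of an $m\times n$ matrix $A$ has vertex set $\{1,\ldots,m\}$ (the rows), two distinct vertices $i,i'$ being adjacent if $A$ contains a column whose $i$-th and $i'$-th entries are both non-zero. The dual tree-depth is $\operatorname{td}_D(A)=\operatorname{td}(G_D(A))$. Branch-depth: a depth-decomposition of a matroid $M=(X,\mathcal{I})$ with rank function $r$ is a pair $(T,f)$ where $T$ is a rooted tree with exactly $r(M)$ edges and $f$ maps $X$ to the leaves of $T$, such that for every $X'\subseteq X$ the rank $r(X')$ is at most the number of edges contained in the union of the paths from the root to the vertices $f(x)$, $x\in X'$. The branch-depth $\operatorname{bd}(M)$ is the smallest depth of a tree $T$ forming a depth-decomposition of $M$. The branch-depth $\operatorname{bd}(A)$ of a matrix $A$ is the branch-depth of the vector matroid whose elements are the columns of $A$ (independence being linear independence).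
   Formalization: The matrix is assumed non-zero if it has at least one row (a zero matrix with rows has branch-depth 0, but dual tree-depth 1), and it is assumed decidable whether an element of the field is zero, which excluded middle supplies for every field. -}

module Defs where

open import Level using (Level; 0ℓ; _⊔_) renaming (suc to lsuc)
open import Algebra.Apartness.Bundles using (HeytingField; HeytingCommutativeRing)
open import Algebra.Bundles using (CommutativeRing)
import Algebra.Properties.Monoid.Sum as MonoidSum
open import Data.Fin.Base using (Fin)
open import Data.Fin.Permutation.Components using (transpose)
import Data.Fin.Properties as Fin
open import Data.Fin.Subset using (Subset; _∈_; _∉_; _⊆_; ∣_∣; ⊤)
open import Data.Fin.Subset.Properties using (_∈?_)
open import Data.List.Base using (List; []; _∷_; _++_; map; filter; length)
open import Data.List.Relation.Unary.Any using (Any; here; there)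
open import Data.Nat.Base as ℕ using (ℕ; _≤_)
open import Data.Product.Base using (∃; ∃₂; _×_; _,_; proj₁)
open import Data.Sum.Base using (_⊎_; swap)
open import Data.Vec.Functional using (Vector; updateAt)
open import Function.Base using (_∘_)
open import Function.Definitions using (Injective)
open import Relation.Binary.Construct.Closure.ReflexiveTransitive using (Star)
open import Relation.Binary.Core using (Rel)
open import Relation.Binary.Definitions using (Symmetric; Irreflexive)
open import Relation.Binary.PropositionalEquality.Core using (_≡_; _≢_; refl; sym)
open import Relation.Nullary.Decidable using (Dec; yes; no; map′; _×-dec_)

IsMinimum : ∀ {p} → (ℕ → Set p) → ℕ → Set p
IsMinimum P k = P k × (∀ l → P l → k ≤ l)

IsMaximum : ∀ {p} → (ℕ → Set p) → ℕ → Set p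
IsMaximum P k = P k × (∀ l → P l → l ≤ k)

------------------------------------------------------------------------
-- Rooted trees and forests

-- The order of the children carries no information: none of the notions
-- below depends on it.
data Tree : Set where
  node : List Tree → Tree

Forest : Set
Forest = List Tree

data Vertex : Tree → Set where
  root  : ∀ {ts} → Vertex (node ts)
  below : ∀ {ts} → Any Vertex ts → Vertex (node ts)

ForestVertex : Forest → Set
ForestVertex = Any Vertex

-- u ≼ v: the vertex u lies on the path from the root to v (possibly u ≡ v).
infix 4 _≼_ _≼ᶠ_ _≼?_ _≼ᶠ?_

mutual
  data _≼_ : ∀ {t} → Vertex t → Vertex t → Set where
    root≼ : ∀ {ts} {v : Vertex (node ts)} → root ≼ v
    below : ∀ {ts} {u v : ForestVertex ts} → u ≼ᶠ v → below u ≼ below v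

  data _≼ᶠ_ : ∀ {ts} → ForestVertex ts → ForestVertex ts → Set where
    here  : ∀ {t ts} {u v : Vertex t} → u ≼ v → here {xs = ts} u ≼ᶠ here v
    there : ∀ {t ts} {u v : ForestVertex ts} → u ≼ᶠ v → there {x = t} u ≼ᶠ there v

mutual
  _≼?_ : ∀ {t} (u v : Vertex t) → Dec (u ≼ v)
  root    ≼? v       = yes root≼
  below u ≼? root    = no λ ()
  below u ≼? below v = map′ below (λ { (below p) → p }) (u ≼ᶠ? v)

  _≼ᶠ?_ : ∀ {ts} (u v : ForestVertex ts) → Dec (u ≼ᶠ v)
  here u  ≼ᶠ? here v  = map′ here (λ { (here p) → p }) (u ≼? v)
  here u  ≼ᶠ? there v = no λ ()
  there u ≼ᶠ? here v  = no λ ()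
  there u ≼ᶠ? there v = map′ there (λ { (there p) → p }) (u ≼ᶠ? v)

-- Height counts vertices on a root-to-leaf path, depth counts edges.
mutual
  height : Tree → ℕ
  height (node ts) = ℕ.suc (forestHeight ts)

  forestHeight : Forest → ℕ
  forestHeight []       = 0
  forestHeight (t ∷ ts) = height t ℕ.⊔ forestHeight ts

mutual
  depth : Tree → ℕ
  depth (node ts) = maxBranch ts

  maxBranch : List Tree → ℕ
  maxBranch []       = 0
  maxBranch (t ∷ ts) = ℕ.suc (depth t) ℕ.⊔ maxBranch ts

mutual
  children : ∀ {t} → Vertex t → List Tree
  children (root {ts}) = ts
  children (below v)   = childrenᶠ v

  childrenᶠ : ∀ {ts} → ForestVertex ts → List Tree
  childrenᶠ (here v)  = children v
  childrenᶠ (there v) = childrenᶠ v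

Leaf : Tree → Set
Leaf t = ∃ λ (v : Vertex t) → children v ≡ []

mutual
  vertices : ∀ t → List (Vertex t)
  vertices (node ts) = root ∷ map below (verticesᶠ ts)

  verticesᶠ : ∀ ts → List (ForestVertex ts)
  verticesᶠ []       = []
  verticesᶠ (t ∷ ts) = map here (vertices t) ++ map there (verticesᶠ ts)

-- An edge is represented by its endpoint farther from the root, so the edges
-- are the non-root vertices, and the edge e lies on the path from the root to
-- v exactly when e ≼ v.
edges : ∀ t → List (Vertex t)
edges (node ts) = map below (verticesᶠ ts)

edgesOnPaths : ∀ {t n} → (Fin n → Leaf t) → Subset n → List (Vertex t)
edgesOnPaths {t} f X =
  filter (λ e → Fin.any? λ x → (x ∈? X) ×-dec (e ≼? proj₁ (f x))) (edges t)

------------------------------------------------------------------------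
-- Tree-depth

record Graph (V : Set) (ℓ : Level) : Set (lsuc ℓ) where
  field
    Adj        : Rel V ℓ
    adj-sym    : Symmetric Adj
    adj-irrefl : Irreflexive _≡_ Adj

open Graph

closure : (F : Forest) → Graph (ForestVertex F) 0ℓ
closure F = record
  { Adj        = λ u v → u ≢ v × (u ≼ᶠ v ⊎ v ≼ᶠ u)
  ; adj-sym    = λ { (u≢v , p) → u≢v ∘ sym , swap p }
  ; adj-irrefl = λ { u≡v (u≢v , _) → u≢v u≡v }
  }

_IsSubgraphOf_ : ∀ {V W ℓ ℓ′} → Graph V ℓ → Graph W ℓ′ → Set (ℓ ⊔ ℓ′)
_IsSubgraphOf_ {V} {W} G H =
  ∃ λ (φ : V → W) → Injective _≡_ _≡_ φ × (∀ {u v} → Adj G u v → Adj H (φ u) (φ v))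

IsTreeDepth : ∀ {V ℓ} → Graph V ℓ → ℕ → Set ℓ
IsTreeDepth G =
  IsMinimum λ h → ∃ λ F → forestHeight F ≡ h × G IsSubgraphOf closure F

------------------------------------------------------------------------
-- Branch-depth

-- A matroid on Fin n enters only through its family of independent sets, so
-- the definitions take that family and do not ask for the matroid axioms.

module _ {n : ℕ} {ℓ : Level} (Independent : Subset n → Set ℓ) where

  IsRank : Subset n → ℕ → Set ℓ
  IsRank X = IsMaximum λ k → ∃ λ Y → Y ⊆ X × Independent Y × ∣ Y ∣ ≡ k

  record DepthDecomposition : Set ℓ where
    field
      tree       : Tree
      leaf       : Fin n → Leaf tree
      edges≡rank : IsRank ⊤ (length (edges tree))
      rank≤edges : ∀ X k → IsRank X k → k ≤ length (edgesOnPaths leaf X)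

  IsBranchDepth : ℕ → Set ℓ
  IsBranchDepth =
    IsMinimum λ d → ∃ λ D → depth (DepthDecomposition.tree D) ≡ d

------------------------------------------------------------------------
-- Matrices over a field

module Matrices {c ℓ₁ ℓ₂ : Level} (𝔽 : HeytingField c ℓ₁ ℓ₂) where

  open HeytingField 𝔽
    using (Carrier; _≈_; _#_; _+_; _*_; 0#; heytingCommutativeRing)
  open CommutativeRing (HeytingCommutativeRing.commutativeRing heytingCommutativeRing)
    using (+-monoid)
  open MonoidSum +-monoid using (sum)

  Matrix : ℕ → ℕ → Set c
  Matrix m n = Vector (Vector Carrier n) m

  infix 4 _≋_ _⟶_

  _≋_ : ∀ {m n} → Rel (Matrix m n) ℓ₁
  A ≋ B = ∀ i j → A i j ≈ B i j

  NonZeroMatrix : ∀ {m n} → Matrix m n → Set ℓ₂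
  NonZeroMatrix A = ∃₂ λ i j → A i j # 0#

  data RowOperation (m : ℕ) : Set (c ⊔ ℓ₂) where
    exchange    : (i j : Fin m) → RowOperation m
    scale       : (i : Fin m) (a : Carrier) → a # 0# → RowOperation m
    addMultiple : (i j : Fin m) → i ≢ j → Carrier → RowOperation m

  apply : ∀ {m n} → RowOperation m → Matrix m n → Matrix m n
  apply (exchange i j)        A = A ∘ transpose i j
  apply (scale i a _)         A = updateAt A i λ row l → a * row l
  apply (addMultiple i j _ a) A = updateAt A i λ row l → row l + a * A j l

  _⟶_ : ∀ {m n} → Rel (Matrix m n) (c ⊔ ℓ₁ ⊔ ℓ₂)
  A ⟶ B = ∃ λ op → apply op A ≋ B

  -- Already symmetric, since every elementary row operation is undone by
  -- another one.
  RowEquivalent : ∀ {m n} → Rel (Matrix m n) (c ⊔ ℓ₁ ⊔ ℓ₂)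
  RowEquivalent = Star _⟶_

  dualGraph : ∀ {m n} → Matrix m n → Graph (Fin m) ℓ₂
  dualGraph A = record
    { Adj        = λ i i′ → i ≢ i′ × ∃ λ j → A i j # 0# × A i′ j # 0#
    ; adj-sym    = λ { (i≢i′ , j , p , q) → i≢i′ ∘ sym , j , q , p }
    ; adj-irrefl = λ { i≡i′ (i≢i′ , _) → i≢i′ i≡i′ }
    }

  IsDualTreeDepth : ∀ {m n} → Matrix m n → ℕ → Set ℓ₂
  IsDualTreeDepth A = IsTreeDepth (dualGraph A)

  -- The columns of A with index in S, as an indexed family, are linearly
  -- independent; repeated columns are distinct elements of the matroid.
  ColumnsIndependent : ∀ {m n} → Matrix m n → Subset n → Set (c ⊔ ℓ₁)
  ColumnsIndependent A S =
    ∀ (a : Vector Carrier _) → (∀ j → j ∉ S → a j ≈ 0#) → (∀ i → sum (λ j → a j * A i j) ≈ 0#) →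
    ∀ j → a j ≈ 0#

  IsMatrixBranchDepth : ∀ {m n} → Matrix m n → ℕ → Set (c ⊔ ℓ₁)
  IsMatrixBranchDepth A = IsBranchDepth (ColumnsIndependent A)

  IsMinDualTreeDepth : ∀ {m n} → Matrix m n → ℕ → Set (c ⊔ ℓ₁ ⊔ ℓ₂)
  IsMinDualTreeDepth A =
    IsMinimum λ d → ∃ λ A′ → RowEquivalent A A′ × IsDualTreeDepth A′ d

{-# OPTIONS --safe #-}

-- Everything is read off the row space W of A. For a set Y of columns let W_Y be the
-- vectors of W supported in Y; its dimension is r(A) − r(∁Y).
--
-- Given a depth-decomposition (T , f), let X_e be the set of columns j with e ≼ f(j).
-- No edge of the subtree of e lies on a path to a column outside X_e, so W_{X_e} has
-- dimension at least the size of that subtree. Going through the edges bottom-up, one can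
-- therefore choose w_e ∈ W_{X_e} independent of the vectors chosen below e, and vectors
-- chosen in different branches are independent because their supports are disjoint. The
-- w_e, one for each of the r(A) edges, form a basis of W. The matrix with these rows
-- (and zero rows) is row-equivalent to A, and two of its rows meet in a column j only if
-- both edges lie on the path to f(j).
--
-- Conversely, given A′ row-equivalent to A and a forest F whose closure contains the dual
-- graph of A′, keep a basis of W among the rows of A′ and delete the vertices of the other
-- rows from F. The remaining rows meeting a column j form a chain in F; sending j to a leaf
-- above that chain gives a depth-decomposition, since the rank of a set of columns is at
-- most the number of rows meeting it.
module Submission where

open import Defs
open import Algebra.Apartness.Bundles using (HeytingField; HeytingCommutativeRing)
import Algebra.Apartness.Properties.HeytingCommutativeRing as HeytingProperties
open import Algebra.Bundles using (CommutativeRing)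
import Algebra.Properties.CommutativeSemigroup as CommutativeSemigroupProperties
import Algebra.Properties.Ring as RingProperties
import Algebra.Properties.Semiring.Sum as SemiringSum
import Data.Empty as Empty
open import Data.Fin.Base using (Fin; zero; suc)
open import Data.Fin.Permutation.Components using (transpose; transpose-inverse)
open import Data.Fin.Properties using (_≟_; any?; all?)
open import Data.Fin.Subset
  using (Subset; inside; outside; _∈_; _∉_; _⊆_; ∣_∣; ⊤; ⊥; ⁅_⁆; _∩_; _∪_; _-_; ∁; Empty)
open import Data.Fin.Subset.Properties
open import Data.List.Base using (List; []; _∷_; _++_; map; filter; length)
open import Data.List.Membership.Propositional using () renaming (_∈_ to _∈ˡ_)
open import Data.List.Membership.Propositional.Properties
  using (∈-map⁺; ∈-map⁻; ∈-++⁺ˡ; ∈-++⁺ʳ; ∈-filter⁺)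
open import Data.List.Properties
  using (length-++; length-map; length-filter; filter-++; filter-none; filter-≐)
import Data.List.Relation.Unary.All as All
import Data.List.Relation.Unary.All.Properties as All
open import Data.List.Relation.Unary.Any using (here; there)
open import Data.List.Relation.Unary.Any.Properties using (++⁺ˡ; ++⁺ʳ)
open import Data.List.Relation.Unary.Unique.Propositional using (Unique; []; _∷_)
import Data.List.Relation.Unary.Unique.Propositional.Properties as Unique
open import Data.Nat.Base as ℕ using (ℕ; zero; suc; _≤_; _<_; z≤n; s≤s)
open import Data.Nat.Induction using (<-rec)
import Data.Nat.Properties as ℕ
open import Data.Product.Base using (∃; _×_; _,_; proj₁; proj₂)
open import Data.Sum.Base as Sum using (_⊎_; inj₁; inj₂; [_,_]′)
open import Data.Vec.Base using ([]; _∷_; here; there; tabulate)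
import Data.Vec.Functional as Vector
open import Data.Vec.Functional.Properties using (updateAt-updates; updateAt-minimal)
open import Data.Vec.Properties using (lookup∘tabulate; lookup⇒[]=; []=⇒lookup)
open import Function.Base using (_∘_; id; case_of_)
open import Level using (Level; Lift)
open import Relation.Binary.Construct.Closure.ReflexiveTransitive using (ε; _◅_; _◅◅_)
open import Relation.Binary.Definitions using (Decidable)
open import Relation.Binary.PropositionalEquality as ≡ using (_≡_; _≢_)
import Relation.Binary.Reasoning.Setoid as ≈-Reasoning
open import Relation.Nullary using (¬_; Dec; yes; no; does; contradiction)
open import Relation.Nullary.Decidable
  using (_×-dec_; ¬?; map′; decidable-stable; dec-true)
open import Relation.Unary using (Pred) renaming (Decidable to Decidableᵘ)

-- Cardinalities of finite subsets.

∣p∪⁅x⁆∣ : ∀ {n} {p : Subset n} {x} → x ∉ p → ∣ p ∪ ⁅ x ⁆ ∣ ≡ suc ∣ p ∣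
∣p∪⁅x⁆∣ {p = inside  ∷ p} {zero}  x∉p = contradiction here x∉p
∣p∪⁅x⁆∣ {p = outside ∷ p} {zero}  x∉p = ≡.cong (suc ∘ ∣_∣) (∪-identityʳ p)
∣p∪⁅x⁆∣ {p = inside  ∷ p} {suc x} x∉p = ≡.cong suc (∣p∪⁅x⁆∣ (x∉p ∘ there))
∣p∪⁅x⁆∣ {p = outside ∷ p} {suc x} x∉p = ∣p∪⁅x⁆∣ (x∉p ∘ there)

∣p-x∣ : ∀ {n} {p : Subset n} {x} → x ∈ p → suc ∣ p - x ∣ ≡ ∣ p ∣
∣p-x∣ {p = _ ∷ p}       here        = ≡.cong (suc ∘ ∣_∣) (p─⊥≡p p)
∣p-x∣ {p = inside  ∷ p} (there x∈p) = ≡.cong suc (∣p-x∣ x∈p)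
∣p-x∣ {p = outside ∷ p} (there x∈p) = ∣p-x∣ x∈p

x∉p-x : ∀ {n} {p : Subset n} {x} → x ∉ p - x
x∉p-x {p = inside  ∷ p} {zero} ()
x∉p-x {p = outside ∷ p} {zero} ()
x∉p-x {p = _ ∷ p} {suc x} (there q) = x∉p-x q

-- Sums and dot products over a field with decidable apartness.

module LinearAlgebra {c ℓ₁ ℓ₂ : Level} (𝔽 : HeytingField c ℓ₁ ℓ₂)
                     (_#?_ : Decidable (HeytingField._#_ 𝔽)) where

  open HeytingField 𝔽
    using (_#_; heytingCommutativeRing; tight; #⇒invertible)
  open CommutativeRing (HeytingCommutativeRing.commutativeRing heytingCommutativeRing)
    hiding (zero; _-_)
  open HeytingProperties heytingCommutativeRing using (1#0; x-0≈x; #-congʳ)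
  open RingProperties ring using (-‿distribˡ-*)
  open SemiringSum semiring
    using (sum; sum-cong-≋; ∑-distrib-+; *-distribˡ-sum; sum-replicate-zero)
  open CommutativeSemigroupProperties +-commutativeSemigroup using (x∙yz≈y∙xz)
  open CommutativeSemigroupProperties *-commutativeSemigroup
    using () renaming (x∙yz≈y∙xz to x*yz≈y*xz)
  open Matrices 𝔽
  open ≈-Reasoning setoid

  private variable
    m n : ℕ

  ¬#0⇒≈0 : ∀ {x} → ¬ x # 0# → x ≈ 0#
  ¬#0⇒≈0 = proj₁ (tight _ _)

  ≈0⇒¬#0 : ∀ {x} → x ≈ 0# → ¬ x # 0#
  ≈0⇒¬#0 = proj₂ (tight _ _)

  inverse : ∀ {x} → x # 0# → ∃ λ y → y * x ≈ 1#
  inverse x#0 with y , yx≈1 , _ ← #⇒invertible x#0 =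
    y , trans (*-congˡ (sym (x-0≈x _))) yx≈1

  #0-cancelˡ : ∀ {x y} → x # 0# → x * y ≈ 0# → y ≈ 0#
  #0-cancelˡ {x} {y} x#0 xy≈0 with x⁻¹ , x⁻¹x≈1 ← inverse x#0 = begin
    y             ≈⟨ *-identityˡ y ⟨
    1# * y        ≈⟨ *-congʳ x⁻¹x≈1 ⟨
    x⁻¹ * x * y   ≈⟨ *-assoc x⁻¹ x y ⟩
    x⁻¹ * (x * y) ≈⟨ *-congˡ xy≈0 ⟩
    x⁻¹ * 0#      ≈⟨ zeroʳ x⁻¹ ⟩
    0#            ∎

  sum-zero : (f : Fin n → Carrier) → (∀ i → f i ≈ 0#) → sum f ≈ 0#
  sum-zero {n} f f≈0 = trans (sum-cong-≋ f≈0) (sum-replicate-zero n)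

  -- Here `g` is `f` with its `i`-th term removed. Leaving `g` arbitrary up to `≈` lets it be a
  -- family of products whose `i`-th factor vanishes, as in `replaceRow`.
  sum-extract : ∀ i (f g : Fin n → Carrier) → g i ≈ 0# → (∀ k → k ≢ i → g k ≈ f k) →
                sum f ≈ f i + sum g
  sum-extract zero f g gᵢ≈0 g≈f = +-congˡ (begin
    sum (f ∘ suc)         ≈⟨ sum-cong-≋ (λ k → g≈f (suc k) λ ()) ⟨
    sum (g ∘ suc)         ≈⟨ +-identityˡ _ ⟨
    0# + sum (g ∘ suc)    ≈⟨ +-congʳ gᵢ≈0 ⟨
    sum g                 ∎)
  sum-extract (suc i) f g gᵢ≈0 g≈f = begin
    f zero + sum (f ∘ suc)
      ≈⟨ +-cong (sym (g≈f zero λ ())) (sum-extract i (f ∘ suc) (g ∘ suc) gᵢ≈0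
           λ k k≢i → g≈f (suc k) λ { ≡.refl → k≢i ≡.refl }) ⟩
    g zero + (f (suc i) + sum (g ∘ suc))
      ≈⟨ x∙yz≈y∙xz _ _ _ ⟩
    f (suc i) + sum g ∎

  sum-single : ∀ i (f : Fin n → Carrier) → (∀ k → k ≢ i → f k ≈ 0#) → sum f ≈ f i
  sum-single {n} i f f≈0 = begin
    sum f                    ≈⟨ sum-extract i f _ refl (λ k k≢i → sym (f≈0 k k≢i)) ⟩
    f i + sum {n} (λ _ → 0#) ≈⟨ +-congˡ (sum-replicate-zero n) ⟩
    f i + 0#                 ≈⟨ +-identityʳ _ ⟩
    f i                      ∎

  infix 8 _·_

  _·_ : (a x : Fin n → Carrier) → Carrier
  a · x = sum λ j → a j * x j

  ·-scale : ∀ (a x : Fin n → Carrier) t → a · (λ j → t * x j) ≈ t * a · x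
  ·-scale a x t = trans (sum-cong-≋ λ j → x*yz≈y*xz (a j) t (x j))
                        (sym (*-distribˡ-sum t λ j → a j * x j))

  ·-addMultiple : ∀ (a x y : Fin n → Carrier) t →
                  a · (λ j → x j + t * y j) ≈ a · x + t * a · y
  ·-addMultiple a x y t = begin
    a · (λ j → x j + t * y j)        ≈⟨ sum-cong-≋ (λ j → distribˡ (a j) (x j) (t * y j)) ⟩
    sum (λ j → a j * x j + a j * (t * y j))
                                     ≈⟨ ∑-distrib-+ (λ j → a j * x j) _ ⟩
    a · x + a · (λ j → t * y j)      ≈⟨ +-congˡ (·-scale a y t) ⟩
    a · x + t * a · y                ∎

  ·-cong : ∀ {a a′ x x′ : Fin n → Carrier} → (∀ j → a j ≈ a′ j) → (∀ j → x j ≈ x′ j) →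
           a · x ≈ a′ · x′
  ·-cong a≈a′ x≈x′ = sum-cong-≋ λ j → *-cong (a≈a′ j) (x≈x′ j)

  ·-zero : ∀ (a x : Fin n → Carrier) → (∀ j → a j ≈ 0# ⊎ x j ≈ 0#) → a · x ≈ 0#
  ·-zero a x ax≈0 = sum-zero _ λ j →
    [ (λ aⱼ≈0 → trans (*-congʳ aⱼ≈0) (zeroˡ _)) , (λ xⱼ≈0 → trans (*-congˡ xⱼ≈0) (zeroʳ _)) ]′
      (ax≈0 j)

  x+ty≈x : ∀ {x y t} → y ≈ 0# → x + t * y ≈ x
  x+ty≈x y≈0 = trans (+-congˡ (trans (*-congˡ y≈0) (zeroʳ _))) (+-identityʳ _)

  -- Row operations and linear relations among columns.

  Kernel : Matrix m n → (Fin n → Carrier) → Set ℓ₁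
  Kernel A a = ∀ i → a · A i ≈ 0#

  row-≡ : ∀ {x y : Fin n → Carrier} → x ≡ y → ∀ l → x l ≈ y l
  row-≡ eq l = reflexive (≡.cong (λ row → row l) eq)

  ·-≡ : ∀ (a : Fin n → Carrier) {x y : Fin n → Carrier} → x ≡ y → a · x ≈ a · y
  ·-≡ a eq = reflexive (≡.cong (a ·_) eq)

  module _ {A : Matrix m n} {a : Fin n → Carrier} where

    Kernel-apply⁺ : ∀ op → Kernel A a → Kernel (apply op A) a
    Kernel-apply⁺ (exchange i j)        ker k = ker (transpose i j k)
    Kernel-apply⁺ (scale i t _)         ker k with k ≟ i
    ... | yes ≡.refl = begin
      a · _                  ≈⟨ ·-≡ a (updateAt-updates i A) ⟩
      a · (λ l → t * A i l)  ≈⟨ ·-scale a (A i) t ⟩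
      t * a · A i            ≈⟨ *-congˡ (ker i) ⟩
      t * 0#                 ≈⟨ zeroʳ t ⟩
      0#                     ∎
    ... | no k≢i = trans (·-≡ a (updateAt-minimal k i A k≢i)) (ker k)
    Kernel-apply⁺ (addMultiple i j _ t) ker k with k ≟ i
    ... | yes ≡.refl = begin
      a · _                            ≈⟨ ·-≡ a (updateAt-updates i A) ⟩
      a · (λ l → A i l + t * A j l)    ≈⟨ ·-addMultiple a (A i) (A j) t ⟩
      a · A i + t * a · A j            ≈⟨ x+ty≈x (ker j) ⟩
      a · A i                          ≈⟨ ker i ⟩
      0#                               ∎
    ... | no k≢i = trans (·-≡ a (updateAt-minimal k i A k≢i)) (ker k)

    -- Undoing `addMultiple` rests on `i ≢ j`: row `j` is intact, so the multiple added to row `i`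
    -- is itself annihilated by `a`. Undoing `scale` cancels the unit.
    Kernel-apply⁻ : ∀ op → Kernel (apply op A) a → Kernel A a
    Kernel-apply⁻ (exchange i j)            ker k =
      ≡.subst (λ k → a · A k ≈ 0#) (transpose-inverse i j) (ker (transpose j i k))
    Kernel-apply⁻ (scale i t t#0)           ker k with k ≟ i
    ... | yes ≡.refl = #0-cancelˡ t#0 (begin
      t * a · A i            ≈⟨ ·-scale a (A i) t ⟨
      a · (λ l → t * A i l)  ≈⟨ ·-≡ a (updateAt-updates i A) ⟨
      a · _                  ≈⟨ ker i ⟩
      0#                     ∎)
    ... | no k≢i = trans (·-≡ a (≡.sym (updateAt-minimal k i A k≢i))) (ker k)
    Kernel-apply⁻ (addMultiple i j i≢j t) ker k with k ≟ i
    ... | yes ≡.refl = begin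
      a · A i                          ≈⟨ x+ty≈x kerⱼ ⟨
      a · A i + t * a · A j            ≈⟨ ·-addMultiple a (A i) (A j) t ⟨
      a · (λ l → A i l + t * A j l)    ≈⟨ ·-≡ a (updateAt-updates i A) ⟨
      a · _                            ≈⟨ ker i ⟩
      0#                               ∎
      where
      kerⱼ : a · A j ≈ 0#
      kerⱼ = trans (·-≡ a (≡.sym (updateAt-minimal j i A (i≢j ∘ ≡.sym)))) (ker j)
    ... | no k≢i = trans (·-≡ a (≡.sym (updateAt-minimal k i A k≢i))) (ker k)

  Kernel-≋ : ∀ {A B : Matrix m n} {a} → A ≋ B → Kernel A a → Kernel B a
  Kernel-≋ A≋B ker i = trans (·-cong (λ _ → refl) (λ j → sym (A≋B i j))) (ker i)

  Kernel-⟶* : ∀ {A B : Matrix m n} {a} → RowEquivalent A B → Kernel A a → Kernel B a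
  Kernel-⟶* ε                  ker = ker
  Kernel-⟶* {A = A} {a = a} ((op , eq) ◅ A⟶*B) ker =
    Kernel-⟶* A⟶*B (Kernel-≋ eq (Kernel-apply⁺ {A = A} {a} op ker))

  Kernel-⟵* : ∀ {A B : Matrix m n} {a} → RowEquivalent A B → Kernel B a → Kernel A a
  Kernel-⟵* ε                  ker = ker
  Kernel-⟵* {A = A} {a = a} ((op , eq) ◅ A⟶*B) ker =
    Kernel-apply⁻ {A = A} {a} op (Kernel-≋ (λ i j → sym (eq i j)) (Kernel-⟵* A⟶*B ker))

  -- Independence of columns refers to the matrix only through its kernel, which row operations
  -- preserve in both directions.
  ColumnsIndependent-⟶* : ∀ {A B : Matrix m n} {S} → RowEquivalent A B →
                          ColumnsIndependent A S → ColumnsIndependent B S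
  ColumnsIndependent-⟶* A⟶*B ind a a∉S≈0 ker = ind a a∉S≈0 (Kernel-⟵* A⟶*B ker)

  ColumnsIndependent-⟵* : ∀ {A B : Matrix m n} {S} → RowEquivalent A B →
                          ColumnsIndependent B S → ColumnsIndependent A S
  ColumnsIndependent-⟵* A⟶*B ind a a∉S≈0 ker = ind a a∉S≈0 (Kernel-⟶* A⟶*B ker)

  -- One `addMultiple` for each `k` with `ι k ≢ i`; an index that hits row `i` has coefficient zero
  -- and is skipped. The rows being added are not altered on the way, so the sum can be written with
  -- the original `A`. The map `ι` lets the recursion drop indices one at a time.
  addRows : ∀ {p} (A : Matrix m n) i (ι : Fin p → Fin m) (c : Fin p → Carrier) →
            (∀ k → ι k ≡ i → c k ≈ 0#) →
            ∃ λ B → RowEquivalent A B ×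
                    (∀ l → B i l ≈ A i l + sum (λ k → c k * A (ι k) l)) ×
                    (∀ k → k ≢ i → ∀ l → B k l ≈ A k l)
  addRows {p = zero}  A i ι c cᵢ≈0 =
    A , ε , (λ l → sym (+-identityʳ _)) , λ _ _ _ → refl
  addRows {p = suc p} A i ι c cᵢ≈0 with ι zero ≟ i
  ... | yes ι₀≡i
    with B , A⟶*B , Bᵢ , B≈A ← addRows A i (ι ∘ suc) (c ∘ suc) (cᵢ≈0 ∘ suc) =
      B , A⟶*B , (λ l → trans (Bᵢ l) (+-congˡ (sym (begin
        c zero * A (ι zero) l + _ ≈⟨ +-congʳ (*-congʳ (cᵢ≈0 zero ι₀≡i)) ⟩
        0# * A (ι zero) l + _     ≈⟨ +-congʳ (zeroˡ _) ⟩
        0# + _                    ≈⟨ +-identityˡ _ ⟩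
        _                         ∎)))) , B≈A
  ... | no ι₀≢i
    with B , A′⟶*B , Bᵢ , B≈A′ ←
           addRows (apply (addMultiple i (ι zero) (ι₀≢i ∘ ≡.sym) (c zero)) A) i
                   (ι ∘ suc) (c ∘ suc) (cᵢ≈0 ∘ suc) =
      B , (op′ , λ _ _ → refl) ◅ A′⟶*B ,
      (λ l → begin
        B i l
          ≈⟨ Bᵢ l ⟩
        A′ i l + sum (λ k → c (suc k) * A′ (ι (suc k)) l)
          ≈⟨ +-cong (row-≡ (updateAt-updates i A) l) (sum-cong-≋ λ k → unchanged k l) ⟩
        A i l + c zero * A (ι zero) l + sum (λ k → c (suc k) * A (ι (suc k)) l)
          ≈⟨ +-assoc _ _ _ ⟩
        A i l + sum (λ k → c k * A (ι k) l) ∎) ,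
      λ k k≢i l → trans (B≈A′ k k≢i l) (row-≡ (updateAt-minimal k i A k≢i) l)
    where
    op′ = addMultiple i (ι zero) (ι₀≢i ∘ ≡.sym) (c zero)
    A′ = apply op′ A

    unchanged : ∀ k l → c (suc k) * A′ (ι (suc k)) l ≈ c (suc k) * A (ι (suc k)) l
    unchanged k l with ι (suc k) ≟ i
    ... | yes ιₖ≡i = trans (*-congʳ (cᵢ≈0 (suc k) ιₖ≡i)) (trans (zeroˡ _)
                      (sym (trans (*-congʳ (cᵢ≈0 (suc k) ιₖ≡i)) (zeroˡ _))))
    ... | no ιₖ≢i  = *-congˡ (row-≡ (updateAt-minimal _ i A ιₖ≢i) l)

  -- Row `i` is first scaled by `c i`, which is legitimate because `c i` is apart from zero; the
  -- other rows are then added with coefficients `c′`, which is `c` with its `i`-th entry cleared.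
  replaceRow : ∀ (A : Matrix m n) (c : Fin m → Carrier) i → c i # 0# →
               ∃ λ B → RowEquivalent A B × (∀ l → B i l ≈ c · λ k → A k l) ×
                       (∀ k → k ≢ i → ∀ l → B k l ≈ A k l)
  replaceRow {m} {n} A c i cᵢ#0 =
    let B , A′⟶*B , Bᵢ , B≈A′ = addRows A′ i id c′ c′-skip in
    B , (scale i (c i) cᵢ#0 , λ _ _ → refl) ◅ A′⟶*B ,
    (λ l → begin
      B i l                                        ≈⟨ Bᵢ l ⟩
      A′ i l + c′ · (λ k → A′ k l)                 ≈⟨ +-congʳ (row-≡ (updateAt-updates i A) l) ⟩
      c i * A i l + c′ · (λ k → A′ k l)            ≈⟨ sum-extract i _ _ (c′A′ᵢ l) (c′A′ l) ⟨
      c · (λ k → A k l)                            ∎) ,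
    λ k k≢i l → trans (B≈A′ k k≢i l) (row-≡ (updateAt-minimal k i A k≢i) l)
    where
    A′ : Matrix m n
    A′ = apply (scale i (c i) cᵢ#0) A

    c′ : Fin m → Carrier
    c′ k with k ≟ i
    ... | yes _ = 0#
    ... | no  _ = c k

    c′-skip : ∀ k → k ≡ i → c′ k ≈ 0#
    c′-skip k k≡i with k ≟ i
    ... | yes _  = refl
    ... | no k≢i = contradiction k≡i k≢i

    c′A′ᵢ : ∀ l → c′ i * A′ i l ≈ 0#
    c′A′ᵢ l = trans (*-congʳ (c′-skip i ≡.refl)) (zeroˡ _)

    c′A′ : ∀ l k → k ≢ i → c′ k * A′ k l ≈ c k * A k l
    c′A′ l k k≢i with k ≟ i
    ... | yes k≡i = contradiction k≡i k≢i
    ... | no _    = *-congˡ (row-≡ (updateAt-minimal k i A k≢i) l)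

  -- Gaussian elimination and rank.

  RowDependency : Matrix m n → Subset m → Subset n → Set _
  RowDependency A Q Z =
    ∃ λ c → (∀ i → i ∉ Q → c i ≈ 0#) × (∃ λ i → i ∈ Q × c i # 0#) ×
            (∀ j → j ∈ Z → c · (λ i → A i j) ≈ 0#)

  ColumnsIndependentOn : Matrix m n → Subset m → Subset n → Set _
  ColumnsIndependentOn A Q Y =
    ∀ a → (∀ j → j ∉ Y → a j ≈ 0#) → (∀ i → i ∈ Q → a · A i ≈ 0#) → ∀ j → a j ≈ 0#

  FullRowRank : Matrix m n → Subset m → Subset n → Set _
  FullRowRank A Q Z = ∃ λ Y → Y ⊆ Z × ∣ Y ∣ ≡ ∣ Q ∣ × ColumnsIndependentOn A Q Y

  module Elimination (A : Matrix (suc m) n) (j₀ : Fin n) (A₀#0 : A zero j₀ # 0#) where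

    A₀⁻¹ : Carrier
    A₀⁻¹ = proj₁ (inverse A₀#0)

    t : Fin m → Carrier
    t i = - (A (suc i) j₀ * A₀⁻¹)

    eliminated : Matrix m n
    eliminated i j = A (suc i) j + t i * A zero j

    eliminated-pivot : ∀ i → eliminated i j₀ ≈ 0#
    eliminated-pivot i = begin
      x + - (x * A₀⁻¹) * A zero j₀    ≈⟨ +-congˡ (-‿distribˡ-* _ _) ⟨
      x + - (x * A₀⁻¹ * A zero j₀)    ≈⟨ +-congˡ (-‿cong (*-assoc _ _ _)) ⟩
      x + - (x * (A₀⁻¹ * A zero j₀))  ≈⟨ +-congˡ (-‿cong (*-congˡ (proj₂ (inverse A₀#0)))) ⟩
      x + - (x * 1#)                  ≈⟨ +-congˡ (-‿cong (*-identityʳ x)) ⟩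
      x + - x                         ≈⟨ -‿inverseʳ x ⟩
      0#                              ∎
      where x = A (suc i) j₀

    -- Each eliminated row is an old row plus `t i` times the pivot row, so the pivot row enters
    -- with total coefficient `c · t`. Column `j₀` costs nothing, as all eliminated rows vanish
    -- there.
    dependency : ∀ {Q Z} → RowDependency eliminated Q (Z - j₀) →
                 RowDependency A (inside ∷ Q) Z
    dependency {Q} {Z} (c , c∉Q≈0 , (i , i∈Q , cᵢ#0) , c·A≈0) =
      c′ , c′∉Q≈0 , (suc i , there i∈Q , cᵢ#0) , c′·A≈0
      where
      c′ : Fin (suc m) → Carrier
      c′ zero    = c · t
      c′ (suc i) = c i

      c′∉Q≈0 : ∀ i → i ∉ inside ∷ Q → c′ i ≈ 0#
      c′∉Q≈0 zero    0∉Q = contradiction here 0∉Q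
      c′∉Q≈0 (suc i) i∉Q = c∉Q≈0 i (i∉Q ∘ there)

      c·A′≈0 : ∀ j → j ∈ Z → c · (λ i → eliminated i j) ≈ 0#
      c·A′≈0 j j∈Z with j ≟ j₀
      ... | yes ≡.refl = ·-zero c _ λ i → inj₂ (eliminated-pivot i)
      ... | no  j≢j₀   = c·A≈0 j (x∈p∧x≢y⇒x∈p-y j∈Z j≢j₀)

      c′·A≈0 : ∀ j → j ∈ Z → c′ · (λ i → A i j) ≈ 0#
      c′·A≈0 j j∈Z = begin
        c · t * y + c · x              ≈⟨ +-comm _ _ ⟩
        c · x + c · t * y              ≈⟨ +-congˡ (*-comm _ _) ⟩
        c · x + y * c · t              ≈⟨ ·-addMultiple c x t y ⟨
        c · (λ i → x i + y * t i)      ≈⟨ ·-cong (λ _ → refl) (λ i → +-congˡ (*-comm y (t i))) ⟩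
        c · (λ i → x i + t i * y)      ≈⟨ c·A′≈0 j j∈Z ⟩
        0#                             ∎
        where
        x : Fin m → Carrier
        x i = A (suc i) j
        y = A zero j

    -- Given a relation `a`, clearing its entry at `j₀` does not change its products with the
    -- eliminated rows, so independence of `Y` makes `a` vanish away from `j₀`. The pivot row then
    -- forces the entry at `j₀` to vanish too.
    fullRank : ∀ {Q Z} → j₀ ∈ Z → FullRowRank eliminated Q (Z - j₀) →
               FullRowRank A (inside ∷ Q) Z
    fullRank {Q} {Z} j₀∈Z (Y , Y⊆Z , ∣Y∣≡∣Q∣ , ind) =
      Y ∪ ⁅ j₀ ⁆ ,
      (λ j∈Y′ → [ p─q⊆p Z _ ∘ Y⊆Z
                , (λ j∈⁅j₀⁆ → ≡.subst (_∈ Z) (≡.sym (x∈⁅y⁆⇒x≡y _ j∈⁅j₀⁆)) j₀∈Z) ]′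
                  (x∈p∪q⁻ Y _ j∈Y′)) ,
      ≡.trans (∣p∪⁅x⁆∣ (x∉p-x ∘ Y⊆Z)) (≡.cong suc ∣Y∣≡∣Q∣) ,
      ind′
      where
      module _ (a : Fin n → Carrier) (a∉Y≈0 : ∀ j → j ∉ Y ∪ ⁅ j₀ ⁆ → a j ≈ 0#)
               (a·A≈0 : ∀ i → i ∈ inside ∷ Q → a · A i ≈ 0#) where

        a′ : Fin n → Carrier
        a′ j with j ≟ j₀
        ... | yes _ = 0#
        ... | no  _ = a j

        a′∉Y≈0 : ∀ j → j ∉ Y → a′ j ≈ 0#
        a′∉Y≈0 j j∉Y with j ≟ j₀
        ... | yes _    = refl
        ... | no  j≢j₀ = a∉Y≈0 j ([ j∉Y , x≢y⇒x∉⁅y⁆ j≢j₀ ]′ ∘ x∈p∪q⁻ Y _)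

        a′≈a : ∀ i j → a′ j * eliminated i j ≈ a j * eliminated i j
        a′≈a i j with j ≟ j₀
        ... | yes ≡.refl = trans (zeroˡ _) (sym (trans (*-congˡ (eliminated-pivot i)) (zeroʳ _)))
        ... | no  _      = refl

        a′·A′≈0 : ∀ i → i ∈ Q → a′ · eliminated i ≈ 0#
        a′·A′≈0 i i∈Q = begin
          a′ · eliminated i                ≈⟨ sum-cong-≋ (a′≈a i) ⟩
          a · eliminated i                 ≈⟨ ·-addMultiple a (A (suc i)) (A zero) (t i) ⟩
          a · A (suc i) + t i * a · A zero ≈⟨ x+ty≈x (a·A≈0 zero here) ⟩
          a · A (suc i)                    ≈⟨ a·A≈0 (suc i) (there i∈Q) ⟩
          0#                               ∎

        a≈0-off-pivot : ∀ j → j ≢ j₀ → a j ≈ 0#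
        a≈0-off-pivot j j≢j₀ with ind a′ a′∉Y≈0 a′·A′≈0 j
        ... | a′ⱼ≈0 with j ≟ j₀
        ...   | yes j≡j₀ = contradiction j≡j₀ j≢j₀
        ...   | no  _    = a′ⱼ≈0

        a₀≈0 : a j₀ ≈ 0#
        a₀≈0 = #0-cancelˡ A₀#0 (begin
          A zero j₀ * a j₀ ≈⟨ *-comm _ _ ⟩
          a j₀ * A zero j₀ ≈⟨ sum-single j₀ _ (λ j j≢j₀ →
                               trans (*-congʳ (a≈0-off-pivot j j≢j₀)) (zeroˡ _)) ⟨
          a · A zero       ≈⟨ a·A≈0 zero here ⟩
          0#               ∎)

        ind′ : ∀ j → a j ≈ 0#
        ind′ j with j ≟ j₀
        ... | yes ≡.refl = a₀≈0
        ... | no  j≢j₀   = a≈0-off-pivot j j≢j₀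

  -- Gaussian elimination, one row of `Q` at a time. This dichotomy is the source of all rank
  -- arguments: the first alternative yields a row-space vector supported off `Z`, the second a
  -- large independent set of columns inside `Z`.
  dependency⊎fullRank : ∀ (A : Matrix m n) Q Z → RowDependency A Q Z ⊎ FullRowRank A Q Z
  dependency⊎fullRank {n = n} A [] Z =
    inj₂ (⊥ , ⊥⊆Z , ∣⊥∣≡0 n , λ a a∉⊥≈0 _ j → a∉⊥≈0 j ∉⊥)
    where
    ⊥⊆Z : ⊥ ⊆ Z
    ⊥⊆Z x∈⊥ = contradiction x∈⊥ ∉⊥
  dependency⊎fullRank A (outside ∷ Q) Z with dependency⊎fullRank (A ∘ suc) Q Z
  ... | inj₁ (c , c∉Q≈0 , (i , i∈Q , cᵢ#0) , c·A≈0) =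
    inj₁ (c′ , c′∉Q≈0 , (suc i , there i∈Q , cᵢ#0) , λ j j∈Z →
      trans (+-congʳ (zeroˡ _)) (trans (+-identityˡ _) (c·A≈0 j j∈Z)))
    where
    c′ : Fin _ → Carrier
    c′ zero    = 0#
    c′ (suc i) = c i

    c′∉Q≈0 : ∀ i → i ∉ outside ∷ Q → c′ i ≈ 0#
    c′∉Q≈0 zero    _   = refl
    c′∉Q≈0 (suc i) i∉Q = c∉Q≈0 i (i∉Q ∘ there)
  ... | inj₂ (Y , Y⊆Z , ∣Y∣≡∣Q∣ , ind) =
    inj₂ (Y , Y⊆Z , ∣Y∣≡∣Q∣ , λ a a∉Y≈0 a·A≈0 → ind a a∉Y≈0 λ i i∈Q → a·A≈0 (suc i) (there i∈Q))
  dependency⊎fullRank A (inside ∷ Q) Z with any? (λ j → (j ∈? Z) ×-dec (A zero j #? 0#))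
  ... | yes (j₀ , j₀∈Z , A₀#0)
    with dependency⊎fullRank (Elimination.eliminated A j₀ A₀#0) Q (Z - j₀)
  ...   | inj₁ dep  = inj₁ (Elimination.dependency A j₀ A₀#0 dep)
  ...   | inj₂ full = inj₂ (Elimination.fullRank A j₀ A₀#0 j₀∈Z full)
  -- Without a pivot in `Z`, the first row alone is a dependency, with coefficient `1#`.
  dependency⊎fullRank A (inside ∷ Q) Z | no A₀≈0 =
    inj₁ (e , e∉Q≈0 , (zero , here , 1#0) , λ j j∈Z → begin
      1# * A zero j + _ ≈⟨ +-cong (*-identityˡ _) (·-zero _ (λ i → A (suc i) j) λ _ → inj₁ refl) ⟩
      A zero j + 0#     ≈⟨ +-identityʳ _ ⟩
      A zero j          ≈⟨ ¬#0⇒≈0 (λ A₀ⱼ#0 → A₀≈0 (j , j∈Z , A₀ⱼ#0)) ⟩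
      0#                ∎)
    where
    e : Fin _ → Carrier
    e zero    = 1#
    e (suc _) = 0#

    e∉Q≈0 : ∀ i → i ∉ inside ∷ Q → e i ≈ 0#
    e∉Q≈0 zero    0∉Q = contradiction here 0∉Q
    e∉Q≈0 (suc _) _   = refl

  -- By the dichotomy for the transposed matrix.
  ∣independent∣≤∣rows∣ : ∀ {A : Matrix m n} {Q Y} → ColumnsIndependentOn A Q Y → ∣ Y ∣ ≤ ∣ Q ∣
  ∣independent∣≤∣rows∣ {A = A} {Q} {Y} ind with dependency⊎fullRank (λ j i → A i j) Y Q
  ... | inj₁ (a , a∉Y≈0 , (j , _ , aⱼ#0) , a·A≈0) =
    contradiction aⱼ#0 (≈0⇒¬#0 (ind a a∉Y≈0 a·A≈0 j))
  ... | inj₂ (P , P⊆Q , ∣P∣≡∣Y∣ , _) = ≡.subst (_≤ ∣ Q ∣) ∣P∣≡∣Y∣ (p⊆q⇒∣p∣≤∣q∣ P⊆Q)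

  -- The rows outside `Q` impose no condition on a vector supported in `Y`.
  independentOn : ∀ {A : Matrix m n} {Q Y} → (∀ i j → i ∉ Q → j ∈ Y → A i j ≈ 0#) →
                  ColumnsIndependent A Y → ColumnsIndependentOn A Q Y
  independentOn {A = A} {Q} {Y} A≈0 ind a a∉Y≈0 a·A≈0 = ind a a∉Y≈0 λ i → case i ∈? Q of λ where
    (yes i∈Q) → a·A≈0 i i∈Q
    (no  i∉Q) → ·-zero a (A i) λ j → case j ∈? Y of λ where
      (yes j∈Y) → inj₂ (A≈0 i j i∉Q j∈Y)
      (no  j∉Y) → inj₁ (a∉Y≈0 j j∉Y)

  -- On the columns `Z`, the rows in `rows` form a row basis and `columns` a column basis. The field
  -- `kept` matters for tree-depth: adjacencies between surviving rows must be those of the original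
  -- matrix.
  record Reduction (A : Matrix m n) (Z : Subset n) : Set (c Level.⊔ ℓ₁ Level.⊔ ℓ₂) where
    field
      reduced       : Matrix m n
      rows          : Subset m
      columns       : Subset n
      rowEquivalent : RowEquivalent A reduced
      kept          : ∀ i → i ∈ rows → ∀ j → reduced i j ≈ A i j
      zeroed        : ∀ i j → i ∉ rows → j ∈ Z → reduced i j ≈ 0#
      columns⊆Z     : columns ⊆ Z
      ∣columns∣     : ∣ columns ∣ ≡ ∣ rows ∣
      independent   : ColumnsIndependent A columns

  -- As long as the rows in `R` are dependent on `Z`, one with coefficient apart from zero is
  -- overwritten by the dependency and leaves `R`. It then vanishes on `Z`, and the rows still in
  -- `R` are untouched. The bound `k` on the size of `R` drives the recursion.
  reduce : ∀ (A : Matrix m n) Z → Reduction A Z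
  reduce {m} {n} A Z = go m A ⊤ (∣p∣≤n {m} ⊤) ε (λ _ _ _ → refl) (λ i j i∉⊤ → contradiction ∈⊤ i∉⊤)
    where
    go : ∀ k (B : Matrix m n) R → ∣ R ∣ ≤ k → RowEquivalent A B →
         (∀ i → i ∈ R → ∀ j → B i j ≈ A i j) → (∀ i j → i ∉ R → j ∈ Z → B i j ≈ 0#) →
         Reduction A Z
    go k B R ∣R∣≤k A⟶*B kept zeroed with dependency⊎fullRank B R Z
    ... | inj₂ (Y , Y⊆Z , ∣Y∣≡∣R∣ , ind) = record
      { reduced = B; rows = R; columns = Y; rowEquivalent = A⟶*B; kept = kept; zeroed = zeroed
      ; columns⊆Z = Y⊆Z; ∣columns∣ = ∣Y∣≡∣R∣
      ; independent = ColumnsIndependent-⟵* A⟶*B λ a a∉Y≈0 ker → ind a a∉Y≈0 λ i _ → ker i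
      }
    go zero B R ∣R∣≤0 _ _ _ | inj₁ (_ , _ , (i , i∈R , _) , _) =
      contradiction (≡.subst (_≤ 0) (≡.sym (∣p-x∣ i∈R)) ∣R∣≤0) λ ()
    go (suc k) B R ∣R∣≤k A⟶*B kept zeroed | inj₁ (c , _ , (i , i∈R , cᵢ#0) , c·B≈0)
      with B′ , B⟶*B′ , B′ᵢ , B′≈B ← replaceRow B c i cᵢ#0 =
      go k B′ (R - i) (ℕ.≤-pred (≡.subst (_≤ suc k) (≡.sym (∣p-x∣ i∈R)) ∣R∣≤k)) (A⟶*B ◅◅ B⟶*B′)
        (λ i′ i′∈R′ j → trans (B′≈B i′ (λ { ≡.refl → x∉p-x i′∈R′ }) j)
                              (kept i′ (p─q⊆p R _ i′∈R′) j))
        λ i′ j i′∉R′ j∈Z → case i′ ≟ i of λ where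
          (yes ≡.refl) → trans (B′ᵢ j) (c·B≈0 j j∈Z)
          (no  i′≢i)   → trans (B′≈B i′ i′≢i j)
                           (zeroed i′ j (λ i′∈R → i′∉R′ (x∈p∧x≢y⇒x∈p-y i′∈R i′≢i)) j∈Z)

-- The ancestor order on rooted forests.

open import Data.Nat.Base using (_+_; _⊔_)
open ≡ using (refl; sym; trans; cong; subst)

private variable
  ℓ : Level
  t : Tree
  ts us : Forest

mutual
  ≼-refl : {v : Vertex t} → v ≼ v
  ≼-refl {v = root}    = root≼
  ≼-refl {v = below v} = below ≼ᶠ-refl

  ≼ᶠ-refl : {v : ForestVertex ts} → v ≼ᶠ v
  ≼ᶠ-refl {v = here v}  = here ≼-refl
  ≼ᶠ-refl {v = there v} = there ≼ᶠ-refl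

mutual
  ≼-trans : {u v w : Vertex t} → u ≼ v → v ≼ w → u ≼ w
  ≼-trans root≼     _         = root≼
  ≼-trans (below p) (below q) = below (≼ᶠ-trans p q)

  ≼ᶠ-trans : {u v w : ForestVertex ts} → u ≼ᶠ v → v ≼ᶠ w → u ≼ᶠ w
  ≼ᶠ-trans (here p)  (here q)  = here (≼-trans p q)
  ≼ᶠ-trans (there p) (there q) = there (≼ᶠ-trans p q)

mutual
  ≼-antisym : {u v : Vertex t} → u ≼ v → v ≼ u → u ≡ v
  ≼-antisym root≼     root≼     = refl
  ≼-antisym (below p) (below q) = cong below (≼ᶠ-antisym p q)

  ≼ᶠ-antisym : {u v : ForestVertex ts} → u ≼ᶠ v → v ≼ᶠ u → u ≡ v
  ≼ᶠ-antisym (here p)  (here q)  = cong here (≼-antisym p q)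
  ≼ᶠ-antisym (there p) (there q) = cong there (≼ᶠ-antisym p q)

mutual
  ≼-chain : {u v w : Vertex t} → u ≼ w → v ≼ w → u ≼ v ⊎ v ≼ u
  ≼-chain root≼     _         = inj₁ root≼
  ≼-chain (below p) root≼     = inj₂ root≼
  ≼-chain (below p) (below q) = Sum.map below below (≼ᶠ-chain p q)

  ≼ᶠ-chain : {u v w : ForestVertex ts} → u ≼ᶠ w → v ≼ᶠ w → u ≼ᶠ v ⊎ v ≼ᶠ u
  ≼ᶠ-chain (here p)  (here q)  = Sum.map here here (≼-chain p q)
  ≼ᶠ-chain (there p) (there q) = Sum.map there there (≼ᶠ-chain p q)

below⁻ : {u v : ForestVertex ts} → below u ≼ below v → u ≼ᶠ v
below⁻ (below p) = p

here⁻ : {u v : Vertex t} → here {xs = ts} u ≼ᶠ here v → u ≼ v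
here⁻ (here p) = p

there⁻ : {u v : ForestVertex ts} → there {x = t} u ≼ᶠ there v → u ≼ᶠ v
there⁻ (there p) = p

here-incomparable-there : {u : Vertex t} {v : ForestVertex ts} →
                          ¬ (here u ≼ᶠ there v ⊎ there v ≼ᶠ here u)
here-incomparable-there (inj₁ ())
here-incomparable-there (inj₂ ())

infix 4 _≟ᶠ_

_≟ᶠ_ : (u v : ForestVertex ts) → Dec (u ≡ v)
u ≟ᶠ v = map′ (λ { (p , q) → ≼ᶠ-antisym p q }) (λ { refl → ≼ᶠ-refl , ≼ᶠ-refl })
              ((u ≼ᶠ? v) ×-dec (v ≼ᶠ? u))

-- Sizes and heights of forests.

size : Forest → ℕ
size ts = length (verticesᶠ ts)

length-vertices : ∀ ts → length (vertices (node ts)) ≡ suc (size ts)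
length-vertices ts = cong suc (length-map below (verticesᶠ ts))

length-edges : ∀ ts → length (edges (node ts)) ≡ size ts
length-edges ts = length-map below (verticesᶠ ts)

size-∷ : ∀ t ts → size (t ∷ ts) ≡ length (vertices t) + size ts
size-∷ t ts = trans (length-++ (map here (vertices t)))
                    (≡.cong₂ _+_ (length-map here (vertices t)) (length-map there (verticesᶠ ts)))

mutual
  vertices-complete : (v : Vertex t) → v ∈ˡ vertices t
  vertices-complete root      = here refl
  vertices-complete (below v) = there (∈-map⁺ below (verticesᶠ-complete v))

  verticesᶠ-complete : (v : ForestVertex ts) → v ∈ˡ verticesᶠ ts
  verticesᶠ-complete (here v)                = ∈-++⁺ˡ (∈-map⁺ here (vertices-complete v))
  verticesᶠ-complete {ts = t ∷ _} (there v)  =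
    ∈-++⁺ʳ (map here (vertices t)) (∈-map⁺ there (verticesᶠ-complete v))

mutual
  vertices-unique : ∀ t → Unique (vertices t)
  vertices-unique (node ts) =
    All.map⁺ (All.universal (λ _ ()) _) ∷ Unique.map⁺ (λ { refl → refl }) (verticesᶠ-unique ts)

  verticesᶠ-unique : ∀ ts → Unique (verticesᶠ ts)
  verticesᶠ-unique []       = []
  verticesᶠ-unique (t ∷ ts) =
    Unique.++⁺ (Unique.map⁺ (λ { refl → refl }) (vertices-unique t))
               (Unique.map⁺ (λ { refl → refl }) (verticesᶠ-unique ts))
               λ (p , q) → disjoint (∈-map⁻ here p) (∈-map⁻ there q)
    where
    disjoint : ∀ {v} → (∃ λ x → x ∈ˡ vertices t × v ≡ here x) →
               ¬ (∃ λ x → x ∈ˡ verticesᶠ ts × v ≡ there x)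
    disjoint (_ , _ , refl) (_ , _ , ())

-- Deleting the root turns every edge into its lower endpoint. This is how depth in edges for
-- `node ts` meets height in vertices for `ts`.
maxBranch≡forestHeight : ∀ ts → maxBranch ts ≡ forestHeight ts
maxBranch≡forestHeight []             = refl
maxBranch≡forestHeight (node us ∷ ts) =
  ≡.cong₂ (λ a b → suc a ⊔ b) (maxBranch≡forestHeight us) (maxBranch≡forestHeight ts)

forestHeight-++ : ∀ ts us → forestHeight (ts ++ us) ≡ forestHeight ts ⊔ forestHeight us
forestHeight-++ []       us = refl
forestHeight-++ (t ∷ ts) us =
  trans (cong (height t ⊔_) (forestHeight-++ ts us)) (sym (ℕ.⊔-assoc (height t) _ _))

-- Concatenating and pruning forests.

++⁺ˡ-≼ᶠ : {u v : ForestVertex ts} → u ≼ᶠ v → ++⁺ˡ {ys = us} u ≼ᶠ ++⁺ˡ v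
++⁺ˡ-≼ᶠ (here p)  = here p
++⁺ˡ-≼ᶠ (there p) = there (++⁺ˡ-≼ᶠ p)

++⁺ʳ-≼ᶠ : ∀ ts {u v : ForestVertex us} → u ≼ᶠ v → ++⁺ʳ ts u ≼ᶠ ++⁺ʳ ts v
++⁺ʳ-≼ᶠ []       p = p
++⁺ʳ-≼ᶠ (_ ∷ ts) p = there (++⁺ʳ-≼ᶠ ts p)

data ++View (ts us : Forest) : ForestVertex (ts ++ us) → Set where
  left  : ∀ u → ++View ts us (++⁺ˡ {ys = us} u)
  right : ∀ u → ++View ts us (++⁺ʳ ts {us} u)

++view : ∀ ts us v → ++View ts us v
++view []       us v        = right v
++view (t ∷ ts) us (here v) = left (here v)
++view (t ∷ ts) us (there v) with ++view ts us v
... | left u  = left (there u)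
... | right u = right u

++view-left : ∀ {ts us} u → ++view ts us (++⁺ˡ {ys = us} u) ≡ left u
++view-left (here u)  = refl
++view-left {_ ∷ _} {us} (there u) rewrite ++view-left {us = us} u = refl

++view-right : ∀ ts {us} u → ++view ts us (++⁺ʳ ts {us} u) ≡ right u
++view-right []       u = refl
++view-right (_ ∷ ts) {us} u rewrite ++view-right ts {us} u = refl

-- Deleting the vertices outside Q; the children of a deleted vertex move up to its parent.
record Pruning {V : Set} (_⊑_ : V → V → Set) (Q : V → Set) (h : ℕ) : Set where
  field
    forest          : Forest
    origin          : ForestVertex forest → V
    origin∈Q        : ∀ x → Q (origin x)
    origin-onto     : ∀ v → Q v → ∃ λ x → origin x ≡ v
    origin-reflects : ∀ x y → origin x ⊑ origin y → x ≼ᶠ y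
    height≤         : forestHeight forest ≤ h

mutual
  -- Pruning a tree returns a forest, because a deleted root leaves the prunings of its child trees
  -- side by side.
  prune : ∀ t {Q} → Decidableᵘ Q → Pruning (_≼_ {t}) Q (height t)
  prune (node ts) {Q} Q? with pruneᶠ ts (Q? ∘ below) | Q? root
  ... | P | yes q = record
    { forest          = node forest ∷ []
    ; origin          = origin′
    ; origin∈Q        = λ { (here root) → q ; (here (below x)) → origin∈Q x }
    ; origin-onto     = λ where
        root      _  → here root , refl
        (below v) Qv → let x , eq = origin-onto v Qv in here (below x) , cong below eq
    ; origin-reflects = λ where
        (here root)      (here _)         _ → here root≼
        (here (below x)) (here (below y)) p → here (below (origin-reflects x y (below⁻ p)))
    ; height≤         = ℕ.⊔-lub (s≤s height≤) z≤n
    }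
    where
    open Pruning P
    origin′ : ForestVertex (node forest ∷ []) → Vertex (node ts)
    origin′ (here root)      = root
    origin′ (here (below x)) = below (origin x)
  ... | P | no ¬q = record
    { forest          = forest
    ; origin          = below ∘ origin
    ; origin∈Q        = origin∈Q
    ; origin-onto     = λ where
        root      Qv → contradiction Qv ¬q
        (below v) Qv → let x , eq = origin-onto v Qv in x , cong below eq
    ; origin-reflects = λ x y p → origin-reflects x y (below⁻ p)
    ; height≤         = ℕ.m≤n⇒m≤1+n height≤
    }
    where open Pruning P

  pruneᶠ : ∀ ts {Q} → Decidableᵘ Q → Pruning (_≼ᶠ_ {ts}) Q (forestHeight ts)
  pruneᶠ []       Q? = record
    { forest          = []
    ; origin          = λ ()
    ; origin∈Q        = λ ()
    ; origin-onto     = λ ()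
    ; origin-reflects = λ ()
    ; height≤         = z≤n
    }
  pruneᶠ (t ∷ ts) {Q} Q? = record
    { forest          = P.forest ++ R.forest
    ; origin          = λ x → origin (view x)
    ; origin∈Q        = λ x → origin∈Q (view x)
    ; origin-onto     = onto
    ; origin-reflects = λ x y → reflects (view x) (view y)
    ; height≤         = subst (_≤ forestHeight (t ∷ ts)) (sym (forestHeight-++ P.forest R.forest))
                              (ℕ.⊔-mono-≤ P.height≤ R.height≤)
    }
    where
    module P = Pruning (prune t (Q? ∘ here))
    module R = Pruning (pruneᶠ ts (Q? ∘ there))
    view = ++view P.forest R.forest

    origin : ∀ {x} → ++View P.forest R.forest x → ForestVertex (t ∷ ts)
    origin (left u)  = here (P.origin u)
    origin (right u) = there (R.origin u)

    origin∈Q : ∀ {x} (v : ++View P.forest R.forest x) → Q (origin v)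
    origin∈Q (left u)  = P.origin∈Q u
    origin∈Q (right u) = R.origin∈Q u

    onto : ∀ v → Q v → ∃ λ x → origin (view x) ≡ v
    onto (here v)  Qv with x , eq ← P.origin-onto v Qv =
      ++⁺ˡ x , trans (cong origin (++view-left x)) (cong here eq)
    onto (there v) Qv with x , eq ← R.origin-onto v Qv =
      ++⁺ʳ P.forest x , trans (cong origin (++view-right P.forest x)) (cong there eq)

    reflects : ∀ {x y} (v : ++View P.forest R.forest x) (w : ++View P.forest R.forest y) →
               origin v ≼ᶠ origin w → x ≼ᶠ y
    reflects (left u)  (left w)  p = ++⁺ˡ-≼ᶠ (P.origin-reflects u w (here⁻ p))
    reflects (right u) (right w) p = ++⁺ʳ-≼ᶠ P.forest (R.origin-reflects u w (there⁻ p))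

-- Leaves above chains.

mutual
  anyVertex? : ∀ t {P : Pred (Vertex t) ℓ} → Decidableᵘ P → Dec (∃ P)
  anyVertex? (node ts) P? with P? root | anyForestVertex? ts (P? ∘ below)
  ... | yes p | _           = yes (root , p)
  ... | no _  | yes (v , p) = yes (below v , p)
  ... | no ¬p | no ¬q       = no λ { (root , p) → ¬p p ; (below v , q) → ¬q (v , q) }

  anyForestVertex? : ∀ ts {P : Pred (ForestVertex ts) ℓ} → Decidableᵘ P → Dec (∃ P)
  anyForestVertex? []       P? = no λ ()
  anyForestVertex? (t ∷ ts) P? with anyVertex? t (P? ∘ here) | anyForestVertex? ts (P? ∘ there)
  ... | yes (v , p) | _           = yes (here v , p)
  ... | no _        | yes (v , p) = yes (there v , p)
  ... | no ¬p       | no ¬q       = no λ { (here v , p) → ¬p (v , p) ; (there v , q) → ¬q (v , q) }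

someLeaf : ∀ t → Leaf t
someLeaf (node [])       = root , refl
someLeaf (node (t ∷ ts)) = let v , eq = someLeaf t in below (here v) , eq

mutual
  -- The search descends into the child tree containing an element of `C`; any leaf will do once
  -- only the root can be left in `C`.
  leafAbove : ∀ t {C : Pred (Vertex t) ℓ} → Decidableᵘ C →
              (∀ {u v} → C u → C v → u ≼ v ⊎ v ≼ u) →
              ∃ λ (l : Leaf t) → ∀ v → C v → v ≼ proj₁ l
  leafAbove (node ts) {C} C? chain with anyForestVertex? ts (C? ∘ below)
  ... | yes (u , Cu)
    with l , leaf , above ← leafAboveᶠ ts (C? ∘ below)
                              (λ Cu Cv → Sum.map below⁻ below⁻ (chain Cu Cv)) u Cu =
      (below l , leaf) , λ { root _ → root≼ ; (below v) Cv → below (above v Cv) }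
  ... | no none =
      someLeaf (node ts) , λ { root _ → root≼ ; (below v) Cv → contradiction (v , Cv) none }

  -- The witness `u` selects the tree to enter and rules out the empty forest, which has no leaf.
  -- Comparability with `u` keeps the rest of `C` in the same tree.
  leafAboveᶠ : ∀ ts {C : Pred (ForestVertex ts) ℓ} → Decidableᵘ C →
               (∀ {u v} → C u → C v → u ≼ᶠ v ⊎ v ≼ᶠ u) → ∀ u → C u →
               ∃ λ l → childrenᶠ l ≡ [] × (∀ v → C v → v ≼ᶠ l)
  leafAboveᶠ (t ∷ ts) C? chain (here u) Cu
    with (l , leaf) , above ← leafAbove t (C? ∘ here)
                                (λ Cu Cv → Sum.map here⁻ here⁻ (chain Cu Cv)) =
      here l , leaf , λ where
        (here v)  Cv → here (above v Cv)
        (there v) Cv → contradiction (chain Cu Cv) here-incomparable-there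
  leafAboveᶠ (t ∷ ts) C? chain (there u) Cu
    with l , leaf , above ← leafAboveᶠ ts (C? ∘ there)
                              (λ Cu Cv → Sum.map there⁻ there⁻ (chain Cu Cv)) u Cu =
      there l , leaf , λ where
        (here v)  Cv → contradiction (chain Cv Cu) here-incomparable-there
        (there v) Cv → there (above v Cv)

-- Subtrees and counting.

mutual
  subtree : Vertex t → Tree
  subtree {t} root  = t
  subtree (below v) = subtreeᶠ v

  subtreeᶠ : ForestVertex ts → Tree
  subtreeᶠ (here v)  = subtree v
  subtreeᶠ (there v) = subtreeᶠ v

length-filter-map : ∀ {A B : Set} {P : Pred B ℓ} (P? : Decidableᵘ P) (f : A → B) xs →
                    length (filter P? (map f xs)) ≡ length (filter (P? ∘ f) xs)
length-filter-map P? f []       = refl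
length-filter-map P? f (x ∷ xs) with P? (f x)
... | yes _ = cong suc (length-filter-map P? f xs)
... | no  _ = length-filter-map P? f xs

private
  regroup : ∀ {a b s x y} → a + s ≤ x → b ≤ y → a + b + s ≤ x + y
  regroup {a} {b} {s} {x} {y} p q = begin
    a + b + s     ≡⟨ ℕ.+-assoc a b s ⟩
    a + (b + s)   ≡⟨ cong (a +_) (ℕ.+-comm b s) ⟩
    a + (s + b)   ≡⟨ ℕ.+-assoc a s b ⟨
    a + s + b     ≤⟨ ℕ.+-mono-≤ p q ⟩
    x + y         ∎
    where open ℕ.≤-Reasoning

  regroup′ : ∀ {a b s x y} → a ≤ x → b + s ≤ y → a + b + s ≤ x + y
  regroup′ {a} {b} {s} p q = ℕ.≤-trans (ℕ.≤-reflexive (ℕ.+-assoc a b s)) (ℕ.+-mono-≤ p q)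

mutual
  -- The vertices satisfying `P` are disjoint from the subtree of `v`. It is applied with `P` saying
  -- that an edge lies on a path to one of a set of columns, none of which hangs below `v`.
  filter-avoiding-subtree : (v : Vertex t) {P : Pred (Vertex t) ℓ} (P? : Decidableᵘ P) →
                            (∀ e → v ≼ e → ¬ P e) →
                            length (filter P? (vertices t)) + length (vertices (subtree v)) ≤
                            length (vertices t)
  filter-avoiding-subtree {t = t} root P? ¬P
    rewrite filter-none P? {xs = vertices t} (All.universal (λ e → ¬P e root≼) _) = ℕ.≤-refl
  filter-avoiding-subtree {t = node ts} (below v) P? ¬P = begin
    length (filter P? (root ∷ map below (verticesᶠ ts))) + s
      -- The root lies outside the subtree and is counted once on the right, so it does no harm
      -- whether or not it satisfies `P`.
      ≤⟨ ℕ.+-monoˡ-≤ s (head≤ (map below (verticesᶠ ts))) ⟩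
    suc (length (filter P? (map below (verticesᶠ ts)))) + s
      ≡⟨ cong (λ k → suc k + s) (length-filter-map P? below (verticesᶠ ts)) ⟩
    suc (length (filter (P? ∘ below) (verticesᶠ ts)) + s)
      ≤⟨ s≤s (filter-avoiding-subtreeᶠ v (P? ∘ below) λ e p → ¬P (below e) (below p)) ⟩
    suc (size ts)
      ≡⟨ length-vertices ts ⟨
    length (vertices (node ts)) ∎
    where
    open ℕ.≤-Reasoning
    s = length (vertices (subtreeᶠ v))
    head≤ : ∀ xs → length (filter P? (root ∷ xs)) ≤ suc (length (filter P? xs))
    head≤ xs with P? root
    ... | yes _ = ℕ.≤-refl
    ... | no _  = ℕ.n≤1+n _

  filter-avoiding-subtreeᶠ : (v : ForestVertex ts) {P : Pred (ForestVertex ts) ℓ}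
                             (P? : Decidableᵘ P) → (∀ e → v ≼ᶠ e → ¬ P e) →
                             length (filter P? (verticesᶠ ts)) + length (vertices (subtreeᶠ v)) ≤
                             size ts
  filter-avoiding-subtreeᶠ {ts = t ∷ ts} v {P} P? ¬P = begin
    length (filter P? (map here (vertices t) ++ map there (verticesᶠ ts))) + s
      ≡⟨ cong (λ xs → length xs + s) (filter-++ P? (map here (vertices t)) _) ⟩
    length (filter P? (map here (vertices t)) ++ filter P? (map there (verticesᶠ ts))) + s
      ≡⟨ cong (_+ s) (length-++ (filter P? (map here (vertices t)))) ⟩
    length (filter P? (map here (vertices t))) + length (filter P? (map there (verticesᶠ ts))) + s
      ≡⟨ cong (_+ s) (≡.cong₂ _+_ (length-filter-map P? here (vertices t))
                                  (length-filter-map P? there (verticesᶠ ts))) ⟩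
    length (filter (P? ∘ here) (vertices t)) + length (filter (P? ∘ there) (verticesᶠ ts)) + s
      ≤⟨ split v ¬P ⟩
    length (vertices t) + size ts
      ≡⟨ size-∷ t ts ⟨
    size (t ∷ ts) ∎
    where
    open ℕ.≤-Reasoning
    s = length (vertices (subtreeᶠ v))
    split : ∀ v → (∀ e → v ≼ᶠ e → ¬ P e) →
            length (filter (P? ∘ here) (vertices t)) + length (filter (P? ∘ there) (verticesᶠ ts)) +
            length (vertices (subtreeᶠ v)) ≤ length (vertices t) + size ts
    split (here v)  ¬P = regroup {length (filter (P? ∘ here) (vertices t))}
      (filter-avoiding-subtree v (P? ∘ here) λ e p → ¬P (here e) (here p))
      (length-filter (P? ∘ there) (verticesᶠ ts))
    split (there v) ¬P = regroup′ (length-filter (P? ∘ here) (vertices t))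
      (filter-avoiding-subtreeᶠ v (P? ∘ there) λ e p → ¬P (there e) (there p))

-- The injective half of a count by bijection; `covered-subset` is the surjective half. Together
-- they equate edges with basis rows.
unique-into-subset : ∀ {A : Set} {m} (g : A → Fin m) → (∀ {x y} → g x ≡ g y → x ≡ y) →
                     ∀ {xs} → Unique xs → (R : Subset m) → (∀ {x} → x ∈ˡ xs → g x ∈ R) →
                     length xs ≤ ∣ R ∣
unique-into-subset g inj []            R g∈R = z≤n
unique-into-subset g inj (x∉xs ∷ uniq) R g∈R = ℕ.≤-trans
  (s≤s (unique-into-subset g inj uniq (R - _) λ y∈xs →
    x∈p∧x≢y⇒x∈p-y (g∈R (there y∈xs)) (All.lookup x∉xs y∈xs ∘ sym ∘ inj)))
  (x∈p⇒∣p-x∣<∣p∣ (g∈R (here refl)))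

∣p∣≤1+∣p-x∣ : ∀ {m} (p : Subset m) x → ∣ p ∣ ≤ suc ∣ p - x ∣
∣p∣≤1+∣p-x∣ p x with x ∈? p
... | yes x∈p = ℕ.≤-reflexive (sym (∣p-x∣ x∈p))
... | no  x∉p = ℕ.m≤n⇒m≤1+n (p⊆q⇒∣p∣≤∣q∣ {p = p} {p - x} λ y∈p →
  x∈p∧x≢y⇒x∈p-y y∈p λ { refl → x∉p y∈p })

covered-subset : ∀ {A : Set} {m} (g : A → Fin m) xs (S : Subset m) →
                 (∀ {i} → i ∈ S → ∃ λ x → x ∈ˡ xs × g x ≡ i) → ∣ S ∣ ≤ length xs
covered-subset {m = m} g [] S cover =
  ℕ.≤-reflexive (trans (cong ∣_∣ (Empty-unique empty)) (∣⊥∣≡0 m))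
  where
  empty : Empty S
  empty (i , i∈S) with _ , () , _ ← cover i∈S
covered-subset g (x ∷ xs) S cover =
  ℕ.≤-trans (∣p∣≤1+∣p-x∣ S (g x)) (s≤s (covered-subset g xs (S - g x) cover′))
  where
  cover′ : ∀ {i} → i ∈ S - g x → ∃ λ y → y ∈ˡ xs × g y ≡ i
  cover′ i∈S′ with cover (p─q⊆p S _ i∈S′)
  ... | _ , here refl  , refl = contradiction i∈S′ x∉p-x
  ... | y , there y∈xs , eq   = y , y∈xs , eq

-- Exhaustive search over forests and functions.

searchForests : ∀ k {P : Pred Forest ℓ} → Decidableᵘ P → (∀ F → P F → size F ≤ k) → Dec (∃ P)
searchForests k P? bound with P? []
... | yes p = yes ([] , p)
searchForests zero P? bound | no ¬p = no λ where
  ([] , p)          → ¬p p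
  (node us ∷ ts , p) → contradiction (bound _ p) λ ()
searchForests (suc k) {P} P? bound | no ¬p =
  map′ (λ { (us , ts , p) → node us ∷ ts , p })
       (λ { ([] , p) → contradiction p ¬p ; (node us ∷ ts , p) → us , ts , p })
       -- The root of the first tree accounts for one vertex, so its child forest `us` and the
       -- remaining trees `ts` each have size at most `k`.
       (searchForests k (λ us → searchForests k (P? ∘ (node us ∷_)) (bound-tail us))
         λ { us (ts , p) → bound-head us ts p })
  where
  size-node : ∀ us ts → size (node us ∷ ts) ≡ suc (size us + size ts)
  size-node us ts = trans (size-∷ (node us) ts) (cong (_+ size ts) (length-vertices us))

  bound-∷ : ∀ us ts → P (node us ∷ ts) → size us + size ts ≤ k
  bound-∷ us ts p = ℕ.≤-pred (subst (_≤ suc k) (size-node us ts) (bound _ p))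

  bound-tail : ∀ us ts → P (node us ∷ ts) → size ts ≤ k
  bound-tail us ts p = ℕ.≤-trans (ℕ.m≤n+m (size ts) (size us)) (bound-∷ us ts p)

  bound-head : ∀ us ts → P (node us ∷ ts) → size us ≤ k
  bound-head us ts p = ℕ.≤-trans (ℕ.m≤m+n (size us) (size ts)) (bound-∷ us ts p)

-- The hypothesis that `P` respects pointwise equality stands in for function extensionality: the
-- search only meets functions built by `Vector.∷`.
searchFunctions : ∀ {A : Set} → (∀ {P : Pred A ℓ} → Decidableᵘ P → Dec (∃ P)) →
                  ∀ n {P : Pred (Fin n → A) ℓ} → Decidableᵘ P →
                  (∀ {f g} → (∀ i → f i ≡ g i) → P f → P g) → Dec (∃ P)
searchFunctions search zero    P? resp =
  map′ (none ,_) (λ { (f , p) → resp (λ ()) p }) (P? none)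
  where
  none : Fin 0 → _
  none ()
searchFunctions search (suc n) {P} P? resp =
  map′ (λ { (x , f , p) → (x Vector.∷ f) , p })
       (λ { (f , p) → f zero , f ∘ suc , resp (λ { zero → refl ; (suc i) → refl }) p })
       (search λ x → searchFunctions search n (λ f → P? (x Vector.∷ f))
         λ f≗g → resp λ { zero → refl ; (suc i) → f≗g i })

-- Its closure is a complete graph, so it contains every graph on `m` vertices. This supplies a
-- first depth-decomposition, from which the minimum is sought.
path : ℕ → Forest
path zero    = []
path (suc m) = node (path m) ∷ []

pathVertex : ∀ {m} → Fin m → ForestVertex (path m)
pathVertex zero    = here root
pathVertex (suc i) = here (below (pathVertex i))

pathVertex-injective : ∀ {m} {i j : Fin m} → pathVertex i ≡ pathVertex j → i ≡ j
pathVertex-injective {i = zero}  {zero}  _  = refl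
pathVertex-injective {i = suc i} {suc j} eq = cong suc (pathVertex-injective (strip eq))
  where
  strip : ∀ {ts} {u v : ForestVertex ts} →
          _≡_ {A = ForestVertex (node ts ∷ [])} (here (below u)) (here (below v)) → u ≡ v
  strip refl = refl

pathVertex-chain : ∀ {m} (i j : Fin m) →
                   pathVertex i ≼ᶠ pathVertex j ⊎ pathVertex j ≼ᶠ pathVertex i
pathVertex-chain zero    j       = inj₁ (zero≼ j)
  where
  zero≼ : ∀ {m} (j : Fin (suc m)) → here root ≼ᶠ pathVertex j
  zero≼ zero    = here root≼
  zero≼ (suc j) = here root≼
pathVertex-chain (suc i) zero    = inj₂ (here root≼)
pathVertex-chain (suc i) (suc j) =
  Sum.map (λ p → here (below p)) (λ p → here (below p)) (pathVertex-chain i j)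

-- Decidable subsets, minima and spare vertices.

subset : ∀ {n ℓ} {P : Pred (Fin n) ℓ} → Decidableᵘ P → Subset n
subset P? = tabulate (does ∘ P?)

module _ {n ℓ} {P : Pred (Fin n) ℓ} (P? : Decidableᵘ P) where

  ∈-subset⁺ : ∀ {i} → P i → i ∈ subset P?
  ∈-subset⁺ {i} p =
    lookup⇒[]= i _ (trans (lookup∘tabulate (does ∘ P?) i) (dec-true (P? i) p))

  ∈-subset⁻ : ∀ {i} → i ∈ subset P? → P i
  ∈-subset⁻ {i} i∈ with P? i | trans (sym (lookup∘tabulate (does ∘ P?) i)) ([]=⇒lookup i∈)
  ... | yes p | _ = p

-- The part of `p` missed by `∁ q ∪ r` lies in `q` without `r`, and `r ⊆ q`.
∣p∣+∣r∣≤ : ∀ {n} (p q r : Subset n) → r ⊆ q → ∣ p ∣ + ∣ r ∣ ≤ ∣ p ∩ (∁ q ∪ r) ∣ + ∣ q ∣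
∣p∣+∣r∣≤ []            []            []            _ = z≤n
∣p∣+∣r∣≤ (outside ∷ p) (outside ∷ q) (outside ∷ r) r⊆q = ∣p∣+∣r∣≤ p q r (drop-∷-⊆ r⊆q)
∣p∣+∣r∣≤ (_ ∷ p)       (outside ∷ q) (inside ∷ r)  r⊆q with () ← r⊆q here
∣p∣+∣r∣≤ (outside ∷ p) (inside ∷ q)  (outside ∷ r) r⊆q =
  ℕ.≤-trans (∣p∣+∣r∣≤ p q r (drop-∷-⊆ r⊆q)) (ℕ.+-monoʳ-≤ ∣ p ∩ (∁ q ∪ r) ∣ (ℕ.n≤1+n _))
∣p∣+∣r∣≤ (outside ∷ p) (inside ∷ q)  (inside ∷ r)  r⊆q
  rewrite ℕ.+-suc ∣ p ∣ ∣ r ∣ | ℕ.+-suc ∣ p ∩ (∁ q ∪ r) ∣ ∣ q ∣ =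
  s≤s (∣p∣+∣r∣≤ p q r (drop-∷-⊆ r⊆q))
∣p∣+∣r∣≤ (inside ∷ p)  (outside ∷ q) (outside ∷ r) r⊆q = s≤s (∣p∣+∣r∣≤ p q r (drop-∷-⊆ r⊆q))
∣p∣+∣r∣≤ (inside ∷ p)  (inside ∷ q)  (outside ∷ r) r⊆q
  rewrite ℕ.+-suc ∣ p ∩ (∁ q ∪ r) ∣ ∣ q ∣ = s≤s (∣p∣+∣r∣≤ p q r (drop-∷-⊆ r⊆q))
∣p∣+∣r∣≤ (inside ∷ p)  (inside ∷ q)  (inside ∷ r)  r⊆q
  rewrite ℕ.+-suc ∣ p ∣ ∣ r ∣ | ℕ.+-suc ∣ p ∩ (∁ q ∪ r) ∣ ∣ q ∣ =
  s≤s (s≤s (∣p∣+∣r∣≤ p q r (drop-∷-⊆ r⊆q)))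

IsMaximum-unique : ∀ {ℓ} {P : ℕ → Set ℓ} {k l} → IsMaximum P k → IsMaximum P l → k ≡ l
IsMaximum-unique (Pk , k-max) (Pl , l-max) = ℕ.≤-antisym (l-max _ Pk) (k-max _ Pl)

minimum : ∀ {ℓ} {P : Pred ℕ ℓ} → Decidableᵘ P → ∀ k → P k → ∃ (IsMinimum P)
minimum {P = P} P? = <-rec _ λ k rec Pk → case ℕ.anyUpTo? P? k of λ where
  (yes (l , l<k , Pl)) → rec l<k Pl
  (no none)            → k , Pk , λ l Pl → ℕ.≮⇒≥ λ l<k → none (l , l<k , Pl)

allSubset? : ∀ {n ℓ} {P : Pred (Subset n) ℓ} → Decidableᵘ P → Dec (∀ X → P X)
allSubset? P? = map′ (λ none X → decidable-stable (P? X) λ ¬p → none (X , ¬p))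
                     (λ all (X , ¬p) → ¬p (all X))
                     (¬? (anySubset? (¬? ∘ P?)))

-- Zero rows are isolated in the dual graph but must still be embedded injectively. One spare
-- singleton tree per row index makes this possible without counting the zero rows.
addIsolated : ℕ → Forest → Forest
addIsolated zero    ts = ts
addIsolated (suc m) ts = node [] ∷ addIsolated m ts

module _ {ts : Forest} where

  isolated : ∀ {m} → Fin m → ForestVertex (addIsolated m ts)
  isolated zero    = here root
  isolated (suc i) = there (isolated i)

  original : ∀ m → ForestVertex ts → ForestVertex (addIsolated m ts)
  original zero    v = v
  original (suc m) v = there (original m v)

  original-≼ᶠ : ∀ m {u v} → u ≼ᶠ v → original m u ≼ᶠ original m v
  original-≼ᶠ zero    p = p
  original-≼ᶠ (suc m) p = there (original-≼ᶠ m p)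

  private
    there-injective : ∀ {t us} {u v : ForestVertex us} →
                      _≡_ {A = ForestVertex (t ∷ us)} (there u) (there v) → u ≡ v
    there-injective refl = refl

  original-injective : ∀ m {u v} → original m u ≡ original m v → u ≡ v
  original-injective zero    eq = eq
  original-injective (suc m) eq = original-injective m (there-injective eq)

  isolated-injective : ∀ {m} {i j : Fin m} → isolated i ≡ isolated j → i ≡ j
  isolated-injective {i = zero}  {zero}  _  = refl
  isolated-injective {i = suc i} {suc j} eq = cong suc (isolated-injective (there-injective eq))

  original≢isolated : ∀ {m v} {i : Fin m} → original m v ≢ isolated i
  original≢isolated {i = suc i} eq = original≢isolated (there-injective eq)

  forestHeight-addIsolated : ∀ m {k} → (0 < m → 1 ≤ k) → forestHeight ts ≤ k →
                             forestHeight (addIsolated m ts) ≤ k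
  forestHeight-addIsolated zero    _   h≤k = h≤k
  forestHeight-addIsolated (suc m) 1≤k h≤k =
    ℕ.⊔-lub (1≤k (s≤s z≤n)) (forestHeight-addIsolated m (λ _ → 1≤k (s≤s z≤n)) h≤k)

leaf? : ∀ {t} (v : Vertex t) → Dec (children v ≡ [])
leaf? v with children v
... | []    = yes refl
... | _ ∷ _ = no λ ()

-- From forests to depth-decompositions.

module BranchDepth {c ℓ₁ ℓ₂ : Level} (𝔽 : HeytingField c ℓ₁ ℓ₂)
                   (_#?_ : Decidable (HeytingField._#_ 𝔽)) where

  open LinearAlgebra 𝔽 _#?_
  open HeytingField 𝔽 using (Carrier; _≈_; _#_; _*_; 0#; heytingCommutativeRing)
  private
    module 𝔽 =
      CommutativeRing (HeytingCommutativeRing.commutativeRing heytingCommutativeRing)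
  open HeytingProperties heytingCommutativeRing using (#-congʳ)
  open Matrices 𝔽

  private variable
    m n : ℕ

  -- The chosen columns attain the value. It is an upper bound because the other rows of the reduced
  -- matrix vanish on `Z`.
  isRank : ∀ {A : Matrix m n} {Z} (ρ : Reduction A Z) →
           IsRank (ColumnsIndependent A) Z ∣ Reduction.rows ρ ∣
  isRank {A = A} {Z} ρ = (columns , columns⊆Z , independent , ∣columns∣) , λ where
      l (Y , Y⊆Z , ind , refl) → ∣independent∣≤∣rows∣ {A = reduced}
        (independentOn (λ i j i∉R j∈Y → zeroed i j i∉R (Y⊆Z j∈Y))
          (ColumnsIndependent-⟶* rowEquivalent ind))
    where open Reduction ρ

  -- Reducing `A′` on all columns leaves as many rows as the rank, and pruning `F` to their images
  -- gives one edge per surviving row. Those rows are unchanged from `A′`, so the comparabilities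
  -- promised by `φ-adj` still hold for them.
  decomposition : ∀ {A A′ : Matrix m n} → RowEquivalent A A′ →
                  ∀ F → dualGraph A′ IsSubgraphOf closure F →
                  ∃ λ (D : DepthDecomposition (ColumnsIndependent A)) →
                    depth (DepthDecomposition.tree D) ≤ forestHeight F
  decomposition {m} {n} {A} {A′} A⟶*A′ F (φ , φ-injective , φ-adj) =
    record { tree = T; leaf = leaf; edges≡rank = edges≡rank; rank≤edges = rank≤edges } ,
    subst (_≤ forestHeight F) (sym (maxBranch≡forestHeight forest)) height≤
    where
    ρ = reduce A′ ⊤
    open Reduction ρ renaming (reduced to B)

    occupied? : Decidableᵘ λ v → ∃ λ i → i ∈ rows × φ i ≡ v
    occupied? v = any? λ i → (i ∈? rows) ×-dec (φ i ≟ᶠ v)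

    open Pruning (pruneᶠ F occupied?)

    T : Tree
    T = node forest

    label : ForestVertex forest → Fin m
    label x = proj₁ (origin∈Q x)

    label∈rows : ∀ x → label x ∈ rows
    label∈rows x = proj₁ (proj₂ (origin∈Q x))

    φ-label : ∀ x → φ (label x) ≡ origin x
    φ-label x = proj₂ (proj₂ (origin∈Q x))

    label-reflects : ∀ x y → φ (label x) ≼ᶠ φ (label y) → x ≼ᶠ y
    label-reflects x y p =
      origin-reflects x y (≡.subst₂ _≼ᶠ_ (φ-label x) (φ-label y) p)

    label-injective : ∀ {x y} → label x ≡ label y → x ≡ y
    label-injective {x} {y} eq =
      ≼ᶠ-antisym (label-reflects x y (subst (λ i → φ (label x) ≼ᶠ φ i) eq ≼ᶠ-refl))
                 (label-reflects y x (subst (λ i → φ i ≼ᶠ φ (label x)) eq ≼ᶠ-refl))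

    label-onto : ∀ {i} → i ∈ rows → ∃ λ x → label x ≡ i
    label-onto {i} i∈R with x , eq ← origin-onto (φ i) (i , i∈R , refl) =
      x , φ-injective (trans (φ-label x) eq)

    ∣edges∣≡∣rows∣ : length (edges T) ≡ ∣ rows ∣
    ∣edges∣≡∣rows∣ = trans (length-edges forest) (ℕ.≤-antisym
      (unique-into-subset label label-injective (verticesᶠ-unique forest) rows
        λ {x} _ → label∈rows x)
      (covered-subset label (verticesᶠ forest) rows λ i∈R →
        let x , eq = label-onto i∈R in x , verticesᶠ-complete x , eq))

    -- Edges are the non-root vertices of `T`, and only they carry rows; the added root carries
    -- none.
    Support : Fin n → Vertex T → Set ℓ₂
    Support j root      = Lift ℓ₂ Empty.⊥
    Support j (below x) = B (label x) j # 0#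

    support? : ∀ j → Decidableᵘ (Support j)
    support? j root      = no λ ()
    support? j (below x) = B (label x) j #? 0#

    B#0⇒A′#0 : ∀ {x j} → B (label x) j # 0# → A′ (label x) j # 0#
    B#0⇒A′#0 {x} {j} = #-congʳ (kept (label x) (label∈rows x) j)

    -- Two distinct kept rows meeting column `j` are adjacent in the dual graph of `A′`, hence
    -- comparable in `F`, and pruning preserves comparability.
    support-chain : ∀ j {u v} → Support j u → Support j v → u ≼ v ⊎ v ≼ u
    support-chain j {below x} {below y} Bx#0 By#0 with label x ≟ label y
    ... | yes eq with refl ← label-injective {x} {y} eq = inj₁ ≼-refl
    ... | no neq =
      Sum.map (λ p → below (label-reflects x y p)) (λ p → below (label-reflects y x p))
        (proj₂ (φ-adj (neq , j , B#0⇒A′#0 {x} Bx#0 , B#0⇒A′#0 {y} By#0)))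

    leaf : Fin n → Leaf T
    leaf j = proj₁ (leafAbove T (support? j) (support-chain j))

    below-leaf : ∀ {x j} → B (label x) j # 0# → below x ≼ proj₁ (leaf j)
    below-leaf {x} {j} = proj₂ (leafAbove T (support? j) (support-chain j)) (below x)

    edges≡rank : IsRank (ColumnsIndependent A) ⊤ (length (edges T))
    edges≡rank rewrite ∣edges∣≡∣rows∣ with (Y , Y⊆⊤ , ind , eq) , max ← isRank ρ =
      (Y , Y⊆⊤ , ColumnsIndependent-⟵* A⟶*A′ ind , eq) , λ where
        l (Y , Y⊆⊤ , ind , eq) → max l (Y , Y⊆⊤ , ColumnsIndependent-⟶* A⟶*A′ ind , eq)

    -- An independent `Y` inside `X` has at most as many elements as there are kept rows meeting it,
    -- and each such row labels an edge on the path to a leaf of `X`.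
    rank≤edges : ∀ X k → IsRank (ColumnsIndependent A) X k → k ≤ length (edgesOnPaths leaf X)
    rank≤edges X _ ((Y , Y⊆X , ind , refl) , _) = begin
      ∣ Y ∣                          ≤⟨ ∣independent∣≤∣rows∣ {A = B} (independentOn zeroOff ind′) ⟩
      ∣ used ∣                       ≤⟨ covered-subset label _ used cover ⟩
      length (filter (onPath? ∘ below) (verticesᶠ forest))
                                     ≡⟨ length-filter-map onPath? below (verticesᶠ forest) ⟨
      length (edgesOnPaths leaf X)   ∎
      where
      open ℕ.≤-Reasoning
      onPath? : Decidableᵘ λ e → ∃ λ j → j ∈ X × e ≼ proj₁ (leaf j)
      onPath? e = any? λ j → (j ∈? X) ×-dec (e ≼? proj₁ (leaf j))

      ind′ : ColumnsIndependent B Y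
      ind′ = ColumnsIndependent-⟶* rowEquivalent (ColumnsIndependent-⟶* A⟶*A′ ind)

      used? : Decidableᵘ λ i → i ∈ rows × ∃ λ j → j ∈ Y × B i j # 0#
      used? i = (i ∈? rows) ×-dec any? λ j → (j ∈? Y) ×-dec (B i j #? 0#)

      used : Subset m
      used = subset used?

      zeroOff : ∀ i j → i ∉ used → j ∈ Y → B i j ≈ 0#
      zeroOff i j i∉used j∈Y = case i ∈? rows of λ where
        (yes i∈R) → ¬#0⇒≈0 λ Bᵢⱼ#0 → i∉used (∈-subset⁺ used? (i∈R , j , j∈Y , Bᵢⱼ#0))
        (no i∉R)  → zeroed i j i∉R ∈⊤

      cover : ∀ {i} → i ∈ used →
              ∃ λ x → x ∈ˡ filter (onPath? ∘ below) (verticesᶠ forest) × label x ≡ i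
      cover i∈used
        with i∈R , j , j∈Y , Bᵢⱼ#0 ← ∈-subset⁻ used? i∈used
        with label-onto i∈R
      ... | x , refl = x , ∈-filter⁺ (onPath? ∘ below) (verticesᶠ-complete x)
                             (j , Y⊆X j∈Y , below-leaf {x} Bᵢⱼ#0) , refl

  -- Choosing a basis of the row space along a tree.

  -- On v j: the column j hangs below v. The field room says that columns outside On v have
  -- rank at most r − weight v.
  record Incidence {V : Set} (A : Matrix m n) (r : ℕ) (_⊑_ : V → V → Set) (weight : V → ℕ)
                   (On : V → Fin n → Set) : Set (c Level.⊔ ℓ₁) where
    field
      on?   : ∀ v j → Dec (On v j)
      chain : ∀ {u v j} → On u j → On v j → u ⊑ v ⊎ v ⊑ u
      room  : ∀ v Y → ColumnsIndependent A Y → (∀ j → j ∈ Y → ¬ On v j) → ∣ Y ∣ + weight v ≤ r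

  -- Restricts the data to a child forest or to one part of a forest. The bound `r` is not lowered,
  -- since `room` concerns the rank in the whole of `A`.
  pullback : ∀ {A : Matrix m n} {r} {V W : Set} {_⊑_ : V → V → Set} {_⊑′_ : W → W → Set} {weight On}
             (f : W → V) → (∀ {u v} → f u ⊑ f v → u ⊑′ v) →
             Incidence A r _⊑_ weight On → Incidence A r _⊑′_ (weight ∘ f) (On ∘ f)
  pullback f f-reflects inc = record
    { on?   = λ v → on? (f v)
    ; chain = λ p q → Sum.map f-reflects f-reflects (chain p q)
    ; room  = λ v → room (f v)
    }
    where open Incidence inc

  -- The free rows are those not yet assigned to an edge; free′ are those still free after
  -- size of them have been moved into place.
  record Placement {V : Set} (On : V → Fin n → Set) (size : ℕ) (B : Matrix m n) (free : Subset m)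
         : Set (c Level.⊔ ℓ₁ Level.⊔ ℓ₂) where
    field
      matrix    : Matrix m n
      reachable : RowEquivalent B matrix
      free′     : Subset m
      free′⊆    : free′ ⊆ free
      count     : size + ∣ free′ ∣ ≡ ∣ free ∣
      unchanged : ∀ i → i ∉ free → ∀ j → matrix i j ≈ B i j
      place     : ∀ {i} → i ∈ free → i ∉ free′ → V
      injective : ∀ {i i′} (p : i ∈ free) q (p′ : i′ ∈ free) q′ → place p q ≡ place p′ q′ → i ≡ i′
      supported : ∀ {i} (p : i ∈ free) q j → matrix i j # 0# → On (place p q) j

  module Cons {t ts} {On : ForestVertex (t ∷ ts) → Fin n → Set}
              {B : Matrix m n} {free} (P : Placement (On ∘ here) (length (vertices t)) B free)
              (P′ : Placement (On ∘ there) (size ts) (Placement.matrix P) (Placement.free′ P)) where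

    private
      module P = Placement P
      module P′ = Placement P′

    placeAt : ∀ {i} → Dec (i ∈ P.free′) → i ∈ free → i ∉ P′.free′ → ForestVertex (t ∷ ts)
    placeAt (yes i∈free′) _ q = there (P′.place i∈free′ q)
    placeAt (no i∉free′)  p _ = here (P.place p i∉free′)

    placeAt-injective : ∀ {i i′} d d′ (p : i ∈ free) q (p′ : i′ ∈ free) q′ →
                        placeAt d p q ≡ placeAt d′ p′ q′ → i ≡ i′
    placeAt-injective (yes d) (yes d′) p q p′ q′ eq = P′.injective d q d′ q′ (strip eq)
      where
      strip : ∀ {u v : ForestVertex ts} → there {x = t} u ≡ there v → u ≡ v
      strip refl = refl
    placeAt-injective (no d) (no d′) p q p′ q′ eq = P.injective p d p′ d′ (strip eq)
      where
      strip : ∀ {u v : Vertex t} → here {xs = ts} u ≡ here v → u ≡ v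
      strip refl = refl

    placeAt-supported : ∀ {i} d (p : i ∈ free) q j → P′.matrix i j # 0# → On (placeAt d p q) j
    placeAt-supported (yes d) p q j B#0 = P′.supported d q j B#0
    placeAt-supported (no d)  p q j B#0 = P.supported p d j (#-congʳ (P′.unchanged _ d j) B#0)

    -- Rows placed in the first tree are no longer free for `P′`, so `P′` leaves them unchanged and
    -- their supports persist. Membership in `P.free′` tells which of the two placements a row
    -- belongs to.
    placement : Placement On (size (t ∷ ts)) B free
    placement = record
      { matrix    = P′.matrix
      ; reachable = P.reachable ◅◅ P′.reachable
      ; free′     = P′.free′
      ; free′⊆    = P.free′⊆ ∘ P′.free′⊆
      ; count     = begin
          size (t ∷ ts) + ∣ P′.free′ ∣                   ≡⟨ cong (_+ ∣ P′.free′ ∣) (size-∷ t ts) ⟩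
          length (vertices t) + size ts + ∣ P′.free′ ∣   ≡⟨ ℕ.+-assoc (length (vertices t)) _ _ ⟩
          length (vertices t) + (size ts + ∣ P′.free′ ∣) ≡⟨ cong (length (vertices t) +_) P′.count ⟩
          length (vertices t) + ∣ P.free′ ∣              ≡⟨ P.count ⟩
          ∣ free ∣                                       ∎
      ; unchanged = λ i i∉free j →
          𝔽.trans (P′.unchanged i (i∉free ∘ P.free′⊆) j) (P.unchanged i i∉free j)
      ; place     = λ {i} → placeAt (i ∈? P.free′)
      ; injective = λ {i} {i′} → placeAt-injective (i ∈? P.free′) (i′ ∈? P.free′)
      ; supported = λ {i} → placeAt-supported (i ∈? P.free′)
      }
      where open ≡.≡-Reasoning

  module Place (A : Matrix m n) (R : Subset m)
               {Y₀ : Subset n} (indep : ColumnsIndependent A Y₀) (∣Y₀∣≡∣R∣ : ∣ Y₀ ∣ ≡ ∣ R ∣) where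

    record State (B : Matrix m n) : Set (c Level.⊔ ℓ₁ Level.⊔ ℓ₂) where
      constructor state
      field
        reachable : RowEquivalent A B
        zeroed    : ∀ i j → i ∉ R → B i j ≈ 0#

    -- The rows in `R` remain independent throughout. Otherwise overwriting row `i` by the
    -- combination would make it zero, leaving fewer possibly nonzero rows than the independent
    -- columns `Y₀`.
    no-vanishing-combination : ∀ {B} → State B → ∀ (c : Fin m → Carrier) →
                               (∀ j → c · (λ i → B i j) ≈ 0#) → ∀ {i} → i ∈ R → ¬ c i # 0#
    no-vanishing-combination {B} (state A⟶*B zeroed) c c·B≈0 {i} i∈R cᵢ#0
      with B′ , B⟶*B′ , B′ᵢ , B′≈B ← replaceRow B c i cᵢ#0 =
        ℕ.<⇒≱ (x∈p⇒∣p-x∣<∣p∣ i∈R) (subst (_≤ ∣ R - i ∣) ∣Y₀∣≡∣R∣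
          (∣independent∣≤∣rows∣ {A = B′}
            (independentOn zeroed′ (ColumnsIndependent-⟶* (A⟶*B ◅◅ B⟶*B′) indep))))
      where
      zeroed′ : ∀ i′ j → i′ ∉ R - i → j ∈ Y₀ → B′ i′ j ≈ 0#
      zeroed′ i′ j i′∉R′ _ with i′ ≟ i
      ... | yes refl = 𝔽.trans (B′ᵢ j) (c·B≈0 j)
      ... | no i′≢i  = 𝔽.trans (B′≈B i′ i′≢i j)
                         (zeroed i′ j λ i′∈R → i′∉R′ (x∈p∧x≢y⇒x∈p-y i′∈R i′≢i))

    step : ∀ {V On size B free} → State B → free ⊆ R → (P : Placement {V = V} On size B free) →
           State (Placement.matrix P)
    step (state A⟶*B zeroed) free⊆R P = state (A⟶*B ◅◅ reachable) λ i j i∉R →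
      𝔽.trans (unchanged i (i∉R ∘ free⊆R) j) (zeroed i j i∉R)
      where open Placement P

    -- The inductive claim for trees and forests. Its last premise says that the rows already fixed
    -- elsewhere, like the zero rows outside `R`, miss all columns hanging here; independence across
    -- branches comes from it.
    Placeable : {V : Set} (_⊑_ : V → V → Set) (weight : V → ℕ) → ℕ → Set _
    Placeable {V} _⊑_ weight size =
      ∀ {On : V → Fin n → Set} → Incidence A ∣ R ∣ _⊑_ weight On →
      ∀ {B} → State B → ∀ free → free ⊆ R → (∀ i → i ∉ free → ∀ v j → On v j → B i j ≈ 0#) →
      Placement On size B free

    module Node {ts} {On : Vertex (node ts) → Fin n → Set}
                (inc : Incidence A ∣ R ∣ _≼_ (length ∘ vertices ∘ subtree) On)
                {B} (st : State B) {free} (free⊆R : free ⊆ R)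
                (avoid : ∀ i → i ∉ free → ∀ v j → On v j → B i j ≈ 0#)
                (P : Placement (On ∘ below) (size ts) B free) where

      open Incidence inc
      open Placement P renaming (matrix to B₁)

      -- All of `R` except the rows just placed strictly below the root. A combination of rows in
      -- `Q` does not involve the vectors chosen below, so it can replace a row without losing them.
      Q : Subset m
      Q = R ∩ (∁ free ∪ free′)

      Z : Subset n
      Z = subset (¬? ∘ on? root)

      -- At least `∣ R ∣` minus `size ts` rows lie in `Q`, whereas `room` allows only `∣ R ∣` minus
      -- `suc (size ts)` independent columns off `On root`. The one unit of difference is the edge
      -- represented by the root of this subtree.
      rank-exceeded : ¬ FullRowRank B₁ Q Z
      rank-exceeded (Y , Y⊆Z , ∣Y∣≡∣Q∣ , ind) = ℕ.<⇒≱ lower upper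
        where
        open ℕ.≤-Reasoning
        upper : ∣ Q ∣ + suc (size ts) ≤ ∣ R ∣
        upper = ≡.subst₂ (λ a b → a + b ≤ ∣ R ∣) ∣Y∣≡∣Q∣ (length-vertices ts)
          (room root Y
            (ColumnsIndependent-⟵* (State.reachable (step st free⊆R P))
              λ a a∉Y≈0 ker → ind a a∉Y≈0 λ i _ → ker i)
            λ j j∈Y → ∈-subset⁻ (¬? ∘ on? root) (Y⊆Z j∈Y))

        lower : ∣ R ∣ < ∣ Q ∣ + suc (size ts)
        lower = ℕ.+-cancelʳ-< ∣ free′ ∣ _ _ (begin-strict
          ∣ R ∣ + ∣ free′ ∣                     ≤⟨ ∣p∣+∣r∣≤ R free free′ free′⊆ ⟩
          ∣ Q ∣ + ∣ free ∣                      ≡⟨ cong (∣ Q ∣ +_) count ⟨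
          ∣ Q ∣ + (size ts + ∣ free′ ∣)         <⟨ ℕ.+-monoʳ-< ∣ Q ∣ ℕ.≤-refl ⟩
          ∣ Q ∣ + (suc (size ts) + ∣ free′ ∣)   ≡⟨ ℕ.+-assoc ∣ Q ∣ _ _ ⟨
          ∣ Q ∣ + suc (size ts) + ∣ free′ ∣     ∎)

      -- A dependency off On root that uses no free row would vanish everywhere,
      -- because the rows placed outside this subtree vanish on On root.
      uses-free-row : ((c , _) : RowDependency B₁ Q Z) → ∃ λ i → i ∈ free′ × c i # 0#
      uses-free-row (c , c∉Q≈0 , (i₀ , i₀∈Q , c₀#0) , c·B≈0)
        with any? (λ i → (i ∈? free′) ×-dec (c i #? 0#))
      ... | yes found = found
      ... | no none   =
        contradiction c₀#0 (no-vanishing-combination (step st free⊆R P) c vanishes (p∩q⊆p R _ i₀∈Q))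
        where
        vanishes : ∀ j → c · (λ i → B₁ i j) ≈ 0#
        vanishes j with on? root j
        ... | no ¬on = c·B≈0 j (∈-subset⁺ (¬? ∘ on? root) ¬on)
        ... | yes on = ·-zero c _ λ i → case i ∈? Q of λ where
          (no i∉Q)  → inj₁ (c∉Q≈0 i i∉Q)
          (yes i∈Q) → case x∈p∪q⁻ (∁ free) free′ (p∩q⊆q R _ i∈Q) of λ where
            (inj₂ i∈free′) → inj₁ (¬#0⇒≈0 λ cᵢ#0 → none (i , i∈free′ , cᵢ#0))
            (inj₁ i∈∁free) → inj₂ (𝔽.trans (unchanged i (x∈∁p⇒x∉p i∈∁free) j)
                                            (avoid i (x∈∁p⇒x∉p i∈∁free) root j on))

      module Root {c : Fin m → Carrier} (c·B≈0 : ∀ j → j ∈ Z → c · (λ i → B₁ i j) ≈ 0#)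
                  {i₀} (i₀∈free′ : i₀ ∈ free′) (c₀#0 : c i₀ # 0#) where

        private
          -- The overwritten row `i₀` is still free, so no row placed earlier is lost.
          replacement = replaceRow B₁ c i₀ c₀#0

        B₂ : Matrix m n
        B₂ = proj₁ replacement

        free″ : Subset m
        free″ = free′ - i₀

        B₂-root : ∀ j → B₂ i₀ j # 0# → On root j
        B₂-root j B₂#0 with on? root j
        ... | yes on = on
        ... | no ¬on = contradiction B₂#0 (≈0⇒¬#0
          (𝔽.trans (proj₁ (proj₂ (proj₂ replacement)) j)
                   (c·B≈0 j (∈-subset⁺ (¬? ∘ on? root) ¬on))))

        B₂≈B₁ : ∀ i → i ≢ i₀ → ∀ j → B₂ i j ≈ B₁ i j
        B₂≈B₁ = proj₂ (proj₂ (proj₂ replacement))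

        ∉free′ : ∀ {i} → i ≢ i₀ → i ∉ free″ → i ∉ free′
        ∉free′ i≢i₀ i∉free″ i∈free′ = i∉free″ (x∈p∧x≢y⇒x∈p-y i∈free′ i≢i₀)

        placeAt : ∀ {i} → Dec (i ≡ i₀) → i ∈ free → i ∉ free″ → Vertex (node ts)
        placeAt (yes _)   _ _ = root
        placeAt (no i≢i₀) p q = below (place p (∉free′ i≢i₀ q))

        placeAt-injective : ∀ {i i′} d d′ (p : i ∈ free) q (p′ : i′ ∈ free) q′ →
                            placeAt d p q ≡ placeAt d′ p′ q′ → i ≡ i′
        placeAt-injective (yes refl) (yes refl) _ _ _ _ _ = refl
        placeAt-injective (no d) (no d′) p q p′ q′ eq =
          injective p (∉free′ d q) p′ (∉free′ d′ q′) (below-injective eq)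
          where
          below-injective : ∀ {u v : ForestVertex ts} → below u ≡ below v → u ≡ v
          below-injective refl = refl

        placeAt-supported : ∀ {i} d (p : i ∈ free) q j → B₂ i j # 0# → On (placeAt d p q) j
        placeAt-supported (yes refl) p q j B₂#0 = B₂-root j B₂#0
        placeAt-supported (no i≢i₀)  p q j B₂#0 =
          supported p (∉free′ i≢i₀ q) j (#-congʳ (B₂≈B₁ _ i≢i₀ j) B₂#0)

        placement : Placement On (length (vertices (node ts))) B free
        placement = record
          { matrix    = B₂
          ; reachable = reachable ◅◅ proj₁ (proj₂ replacement)
          ; free′     = free″
          ; free′⊆    = free′⊆ ∘ p─q⊆p free′ _
          ; count     = begin
              length (vertices (node ts)) + ∣ free″ ∣ ≡⟨ cong (_+ ∣ free″ ∣) (length-vertices ts) ⟩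
              suc (size ts + ∣ free″ ∣)               ≡⟨ ℕ.+-suc (size ts) _ ⟨
              size ts + suc ∣ free″ ∣                 ≡⟨ cong (size ts +_) (∣p-x∣ i₀∈free′) ⟩
              size ts + ∣ free′ ∣                     ≡⟨ count ⟩
              ∣ free ∣                                  ∎
          ; unchanged = λ i i∉free j →
              𝔽.trans (B₂≈B₁ i (λ { refl → i∉free (free′⊆ i₀∈free′) }) j) (unchanged i i∉free j)
          ; place     = λ {i} → placeAt (i ≟ i₀)
          ; injective = λ {i} {i′} → placeAt-injective (i ≟ i₀) (i′ ≟ i₀)
          ; supported = λ {i} → placeAt-supported (i ≟ i₀)
          }
          where open ≡.≡-Reasoning

      placement : Placement On (length (vertices (node ts))) B free
      placement with dependency⊎fullRank B₁ Q Z
      ... | inj₂ full = contradiction full rank-exceeded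
      ... | inj₁ dep@(_ , _ , _ , c·B≈0) with i₀ , i₀∈free′ , c₀#0 ← uses-free-row dep =
        Root.placement c·B≈0 i₀∈free′ c₀#0

    mutual
      -- Children come first, so that the vector for the root can be chosen to avoid the rows used
      -- below it.
      placeTree : ∀ t → Placeable (_≼_ {t}) (length ∘ vertices ∘ subtree) (length (vertices t))
      placeTree (node ts) inc st free free⊆R avoid =
        Node.placement inc st free⊆R avoid
          (placeForest ts (pullback below below⁻ inc) st free free⊆R
            λ i i∉free v → avoid i i∉free (below v))

      placeForest : ∀ ts → Placeable (_≼ᶠ_ {ts}) (length ∘ vertices ∘ subtreeᶠ) (size ts)
      placeForest [] inc {B} st free free⊆R avoid = record
        { matrix    = B
        ; reachable = ε
        ; free′     = free
        ; free′⊆    = id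
        ; count     = refl
        ; unchanged = λ _ _ _ → 𝔽.refl
        ; place     = λ p q → contradiction p q
        ; injective = λ p q → contradiction p q
        ; supported = λ p q → contradiction p q
        }
      placeForest (t ∷ ts) {On} inc {B} st free free⊆R avoid = Cons.placement P
        (placeForest ts (pullback there there⁻ inc) (step st free⊆R P)
          P.free′ (free⊆R ∘ P.free′⊆) avoid′)
        where
        P : Placement (On ∘ here) (length (vertices t)) B free
        P = placeTree t (pullback here here⁻ inc) st free free⊆R
              λ i i∉free v → avoid i i∉free (here v)
        module P = Placement P

        -- A row just placed in `t` meets only columns hanging at its place. Such a column hanging
        -- also in `ts` would make vertices of different trees comparable.
        avoid′ : ∀ i → i ∉ P.free′ → ∀ v j → On (there v) j → P.matrix i j ≈ 0#
        avoid′ i i∉free′ v j on with i ∈? free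
        ... | no i∉free  = 𝔽.trans (P.unchanged i i∉free j) (avoid i i∉free (there v) j on)
        ... | yes i∈free = ¬#0⇒≈0 λ B#0 →
          here-incomparable-there (Incidence.chain inc (P.supported i∈free i∉free′ j B#0) on)

  -- From depth-decompositions to row-equivalent matrices.

  rank>0 : ∀ {A : Matrix m n} → NonZeroMatrix A → ¬ IsRank (ColumnsIndependent A) ⊤ 0
  rank>0 {A = A} (i , j , Aᵢⱼ#0) (_ , max) =
    contradiction (max 1 (⁅ j ⁆ , ⊆-max _ , ind , ∣⁅x⁆∣≡1 j)) λ ()
    where
    ind : ColumnsIndependent A ⁅ j ⁆
    ind a a∉≈0 ker k with k ≟ j
    ... | no k≢j   = a∉≈0 k (x≢y⇒x∉⁅y⁆ k≢j)
    ... | yes refl = #0-cancelˡ Aᵢⱼ#0 (𝔽.trans (𝔽.*-comm _ _) (𝔽.trans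
      (𝔽.sym (sum-single j (λ l → a l * A i l) λ l l≢j →
        𝔽.trans (𝔽.*-congʳ (a∉≈0 l (x≢y⇒x∉⁅y⁆ l≢j))) (𝔽.zeroˡ _)))
      (ker i)))

  -- The forest is the tree without its root, plus singletons for zero rows. An inequality of
  -- heights is enough here, since `decomposition` bounds every forest from below.
  realization : ∀ {A : Matrix m n} → (0 < m → NonZeroMatrix A) →
                (D : DepthDecomposition (ColumnsIndependent A)) →
                ∃ λ A′ → RowEquivalent A A′ × ∃ λ F →
                  forestHeight F ≤ depth (DepthDecomposition.tree D) ×
                  dualGraph A′ IsSubgraphOf closure F
  realization {m} {n} {A} nonzero
    record { tree = node ts ; leaf = leaf ; edges≡rank = edges≡rank ; rank≤edges = rank≤edges } =
      matrix , rowEquivalent ◅◅ reachable , addIsolated m ts ,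
      subst (forestHeight (addIsolated m ts) ≤_) (sym (maxBranch≡forestHeight ts))
        (forestHeight-addIsolated m (λ 0<m → height>0 ts edges≡rank (nonzero 0<m)) ℕ.≤-refl) ,
      (λ i → φ (i ∈? rows)) , (λ {i} {i′} → φ-injective (i ∈? rows) (i′ ∈? rows)) , φ-adj
    where
    ρ = reduce A ⊤
    open Reduction ρ renaming (reduced to B)

    height>0 : ∀ us → IsRank (ColumnsIndependent A) ⊤ (length (edges (node us))) →
               NonZeroMatrix A → 1 ≤ forestHeight us
    -- A one-vertex tree would force rank zero. This must be excluded: its depth is 0, whereas any
    -- forest receiving a row has height at least 1.
    height>0 []              rank nz = contradiction rank (rank>0 nz)
    height>0 (node us ∷ vs) _    _  = ℕ.m≤n⇒m≤n⊔o (forestHeight vs) (s≤s z≤n)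

    size≡∣rows∣ : size ts ≡ ∣ rows ∣
    size≡∣rows∣ = trans (sym (length-edges ts)) (IsMaximum-unique edges≡rank (isRank ρ))

    On : ForestVertex ts → Fin n → Set
    On v j = below v ≼ proj₁ (leaf j)

    -- No path to a column of `Y` enters the subtree of `v`, for every edge there lies below `v`. So
    -- the edges on those paths and the subtree fit together among all edges, whose number is the
    -- rank.
    room : ∀ v Y → ColumnsIndependent A Y → (∀ j → j ∈ Y → ¬ On v j) →
           ∣ Y ∣ + length (vertices (subtreeᶠ v)) ≤ ∣ rows ∣
    room v Y ind off = begin
      ∣ Y ∣ + s                                   ≤⟨ ℕ.+-monoˡ-≤ s (rank≤edges Y ∣ Y ∣ rankY) ⟩
      length (edgesOnPaths leaf Y) + s
        ≡⟨ cong (_+ s) (length-filter-map onPath? below (verticesᶠ ts)) ⟩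
      length (filter (onPath? ∘ below) (verticesᶠ ts)) + s
        ≤⟨ filter-avoiding-subtreeᶠ v (onPath? ∘ below) (λ e v≼e (j , j∈Y , e≼leaf) →
             off j j∈Y (≼-trans (below v≼e) e≼leaf)) ⟩
      size ts                                       ≡⟨ size≡∣rows∣ ⟩
      ∣ rows ∣                                      ∎
      where
      open ℕ.≤-Reasoning
      s = length (vertices (subtreeᶠ v))

      onPath? : Decidableᵘ λ e → ∃ λ j → j ∈ Y × e ≼ proj₁ (leaf j)
      onPath? e = any? λ j → (j ∈? Y) ×-dec (e ≼? proj₁ (leaf j))

      rankY : IsRank (ColumnsIndependent A) Y ∣ Y ∣
      rankY = (Y , id , ind , refl) , λ { _ (X , X⊆Y , _ , refl) → p⊆q⇒∣p∣≤∣q∣ X⊆Y }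

    open Place A rows independent ∣columns∣

    incidence : Incidence A ∣ rows ∣ _≼ᶠ_ (length ∘ vertices ∘ subtreeᶠ) On
    incidence = record
      { on?   = λ v j → below v ≼? proj₁ (leaf j)
      ; chain = λ p q → Sum.map below⁻ below⁻ (≼-chain p q)
      ; room  = room
      }

    placement : Placement On (size ts) B rows
    placement = placeForest ts incidence
      (state rowEquivalent λ i j i∉R → zeroed i j i∉R ∈⊤) rows id
      λ i i∉R _ j _ → zeroed i j i∉R ∈⊤

    open Placement placement

    -- There are as many edges as basis rows, so no row stays free.
    ∉free′ : ∀ {i} → i ∉ free′
    ∉free′ {i} i∈free′ = ℕ.n≮0 (subst (∣ free′ - i ∣ <_) ∣free′∣≡0 (x∈p⇒∣p-x∣<∣p∣ i∈free′))
      where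
      ∣free′∣≡0 : ∣ free′ ∣ ≡ 0
      ∣free′∣≡0 = ℕ.+-cancelˡ-≡ (size ts) _ _
        (trans count (trans (sym size≡∣rows∣) (sym (ℕ.+-identityʳ _))))

    φ : ∀ {i} → Dec (i ∈ rows) → ForestVertex (addIsolated m ts)
    φ     (yes i∈R) = original m (place i∈R ∉free′)
    φ {i} (no _)    = isolated i

    φ-injective : ∀ {i i′} d d′ → φ {i} d ≡ φ {i′} d′ → i ≡ i′
    φ-injective (yes p) (yes p′) eq = injective p ∉free′ p′ ∉free′ (original-injective m eq)
    φ-injective (no _)  (no _)   eq = isolated-injective eq
    φ-injective (yes _) (no _)   eq = contradiction eq original≢isolated
    φ-injective (no _)  (yes _)  eq = contradiction (sym eq) original≢isolated

    φ-comparable : ∀ {i i′ j} d d′ → matrix i j # 0# → matrix i′ j # 0# →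
                   φ {i} d ≼ᶠ φ {i′} d′ ⊎ φ d′ ≼ᶠ φ d
    φ-comparable {j = j} (yes p) (yes p′) M#0 M′#0 =
      Sum.map (λ q → original-≼ᶠ m (below⁻ q)) (λ q → original-≼ᶠ m (below⁻ q))
        (≼-chain (supported p ∉free′ j M#0) (supported p′ ∉free′ j M′#0))
    φ-comparable {i} {j = j} (no i∉R) _ M#0 _ = contradiction M#0 (≈0⇒¬#0 (vanish i∉R))
      where
      vanish : ∀ {i} → i ∉ rows → matrix i j ≈ 0#
      vanish {i} i∉R = 𝔽.trans (unchanged i i∉R j) (zeroed i j i∉R ∈⊤)
    φ-comparable {j = j} (yes _) (no i∉R) _ M#0 =
      contradiction M#0 (≈0⇒¬#0 (𝔽.trans (unchanged _ i∉R j) (zeroed _ j i∉R ∈⊤)))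

    φ-adj : ∀ {i i′} → Graph.Adj (dualGraph matrix) i i′ →
            Graph.Adj (closure (addIsolated m ts)) (φ (i ∈? rows)) (φ (i′ ∈? rows))
    φ-adj {i} {i′} (i≢i′ , _ , M#0 , M′#0) =
      i≢i′ ∘ φ-injective (i ∈? rows) (i′ ∈? rows) , φ-comparable (i ∈? rows) (i′ ∈? rows) M#0 M′#0

  -- Decidability of the attained depths.

  rankOf : ∀ (A : Matrix m n) X → ∃ (IsRank (ColumnsIndependent A) X)
  rankOf A X = _ , isRank (reduce A X)

  -- Makes the minimum constructive: the tree must have exactly `r` edges, so there are finitely
  -- many candidates, and computed ranks turn the defining inequalities into decidable ones.
  hasDepth? : ∀ (A : Matrix m n) →
              Decidableᵘ λ d → ∃ λ (D : DepthDecomposition (ColumnsIndependent A)) →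
                              depth (DepthDecomposition.tree D) ≡ d
  hasDepth? {m} {n} A d = map′ toDecomposition fromDecomposition
    (searchForests r {Good} good? λ F (eq , _) → ℕ.≤-reflexive (trans (sym (length-edges F)) eq))
    where
    r = proj₁ (rankOf A ⊤)

    onPath? : ∀ {t} (g : Fin n → Vertex t) (X : Subset n) → Decidableᵘ λ e → ∃ λ j → j ∈ X × e ≼ g j
    onPath? g X e = any? λ j → (j ∈? X) ×-dec (e ≼? g j)

    -- Values are vertices, with being a leaf as a separate condition, so that the search runs over
    -- vertices alone.
    LeafMap : ∀ t → (Fin n → Vertex t) → Set
    LeafMap t g = (∀ j → children (g j) ≡ []) ×
                  (∀ X → proj₁ (rankOf A X) ≤ length (filter (onPath? g X) (edges t)))

    Good : Forest → Set
    Good F = length (edges (node F)) ≡ r × depth (node F) ≡ d × ∃ (LeafMap (node F))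

    leafMap? : ∀ t → Decidableᵘ (LeafMap t)
    leafMap? t g = all? (λ j → leaf? (g j)) ×-dec allSubset? λ X → _ ℕ.≤? _

    LeafMap-resp : ∀ t {f g} → (∀ j → f j ≡ g j) → LeafMap t f → LeafMap t g
    LeafMap-resp t {f} {g} f≗g (leaf , rank≤) =
      (λ j → subst (λ v → children v ≡ []) (f≗g j) (leaf j)) ,
      λ X → subst (proj₁ (rankOf A X) ≤_)
        (cong length (filter-≐ (onPath? f X) (onPath? g X)
          ( (λ (j , j∈X , p) → j , j∈X , subst (_ ≼_) (f≗g j) p)
          , (λ (j , j∈X , p) → j , j∈X , subst (_ ≼_) (sym (f≗g j)) p))
          (edges t)))
        (rank≤ X)

    good? : Decidableᵘ Good
    good? F = (length (edges (node F)) ℕ.≟ r) ×-dec (depth (node F) ℕ.≟ d) ×-dec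
      searchFunctions (anyVertex? (node F)) n (leafMap? (node F)) (LeafMap-resp (node F))

    toDecomposition : ∃ Good → ∃ λ D → depth (DepthDecomposition.tree D) ≡ d
    toDecomposition (F , edges≡r , depth≡d , g , leaf , rank≤) = record
      { tree       = node F
      ; leaf       = λ j → g j , leaf j
      ; edges≡rank = subst (IsRank (ColumnsIndependent A) ⊤) (sym edges≡r) (proj₂ (rankOf A ⊤))
      ; rank≤edges = λ X k rank →
          subst (_≤ _) (IsMaximum-unique (proj₂ (rankOf A X)) rank) (rank≤ X)
      } , depth≡d

    fromDecomposition : (∃ λ D → depth (DepthDecomposition.tree D) ≡ d) → ∃ Good
    fromDecomposition
      ( record { tree = node F ; leaf = leaf ; edges≡rank = edges≡rank ; rank≤edges = rank≤edges }
      , depth≡d) =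
      F , IsMaximum-unique edges≡rank (proj₂ (rankOf A ⊤)) , depth≡d , proj₁ ∘ leaf ,
      proj₂ ∘ leaf , λ X → rank≤edges X _ (proj₂ (rankOf A X))

theorem1 : ∀ {c ℓ₁ ℓ₂ : Level} (𝔽 : HeytingField c ℓ₁ ℓ₂) → Decidable (HeytingField._#_ 𝔽) →
    let open Matrices 𝔽 in
    ∀ {m n : ℕ} (A : Matrix m n) → (0 < m → NonZeroMatrix A) →
    ∃ λ d → IsMatrixBranchDepth A d × IsMinDualTreeDepth A d
theorem1 𝔽 _#?_ {m} {n} A nonzero
  -- The path on `m` vertices starts the search for a minimal depth.
  with D₀ , _ ← BranchDepth.decomposition 𝔽 _#?_ {A = A} ε (path m)
                  (pathVertex , pathVertex-injective , λ {i} {j} (i≢j , _) →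
                    i≢j ∘ pathVertex-injective , pathVertex-chain i j)
  with d , (D , refl) , minimal ← minimum (BranchDepth.hasDepth? 𝔽 _#?_ A) _ (D₀ , refl)
  with A′ , A⟶*A′ , F , height≤ , sub ← BranchDepth.realization 𝔽 _#?_ nonzero D =
    d , ((D , refl) , minimal) ,
    -- `realization` gives height at most `d` and `bound` at least `d`, so `F` attains the
    -- tree-depth of `A′`; `bound` also covers every other row-equivalent matrix.
    (A′ , A⟶*A′ , (F , ℕ.≤-antisym height≤ (bound A⟶*A′ F sub) , sub) ,
      λ { _ (F′ , refl , sub′) → bound A⟶*A′ F′ sub′ }) ,
    λ { _ (A″ , A⟶*A″ , (F′ , refl , sub′) , _) → bound A⟶*A″ F′ sub′ }
  where
  open Matrices 𝔽
  bound : ∀ {A″} → RowEquivalent A A″ → ∀ F → dualGraph A″ IsSubgraphOf closure F →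
          d ≤ forestHeight F
  bound A⟶*A″ F sub with D , depth≤ ← BranchDepth.decomposition 𝔽 _#?_ A⟶*A″ F sub =
    ℕ.≤-trans (minimal _ (D , refl)) depth≤
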